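{- For every integer $r\ge 5$, $f_{r-1}(r+1,r)=\rho_{r-1}\big(T_r(r+2)\big)$.
   Context: All graphs are finite and simple. For integers $\Delta,\omega$, let $\mathcal{G}(\Delta,\omega)$ be the class of graphs $G$ with maximum degree $\Delta(G)\le\Delta$ and clique number $\omega(G)\le\omega$. For a graph $G$, $k_t(G)$ denotes the number of copies of $K_t$ in $G$, and $\rho_t(G)=k_t(G)/|V(G)|$. For a positive integer $n$ let $k_t(n,\Delta,\omega)=\max\{k_t(G): |V(G)|=n,\ G\in\mathcal{G}(\Delta,\omega)\}$, and define $f_t(\Delta,\omega)=\lim_{n\to\infty}k_t(n,\Delta,\omega)/n$ (this limit exists and equals $\sup_{n}k_t(n,\Delta,\omega)/n$). $T_r(n)$ denotes the Turán graph: the complete $r$-partite graph on $n$ vertices whose part sizes differ by at most one. -}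

module Defs where

open import Data.Nat using (ℕ; zero; suc; _+_; _*_; _∸_; _≤_; _≡ᵇ_; NonZero)
open import Data.Nat.DivMod using (_%_)
open import Data.Bool using (Bool; true; false; not; _∧_; _∨_; if_then_else_)
open import Data.Fin using (Fin; toℕ; _≟_)
open import Data.Fin.Subset using (Subset; ∣_∣)
open import Data.List using (List; []; _∷_; map; _++_; allFin; foldr)
open import Data.Vec using (Vec; lookup) renaming ([] to []ᵥ; _∷_ to _∷ᵥ_)
open import Relation.Nullary.Decidable using (⌊_⌋)
open import Relation.Binary.PropositionalEquality using (_≡_; refl; cong)

record Graph (n : ℕ) : Set where
  field
    adj    : Fin n → Fin n → Bool
    sym    : ∀ i j → adj i j ≡ adj j i
    irrefl : ∀ i → adj i i ≡ false
open Graph public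

count : {A : Set} → (A → Bool) → List A → ℕ
count p [] = 0
count p (x ∷ xs) = (if p x then 1 else 0) + count p xs

allSubsets : (n : ℕ) → List (Subset n)
allSubsets zero = []ᵥ ∷ []
allSubsets (suc n) = map (false ∷ᵥ_) (allSubsets n) ++ map (true ∷ᵥ_) (allSubsets n)

allB : {A : Set} → (A → Bool) → List A → Bool
allB p = foldr (λ x b → p x ∧ b) true

isClique : {n : ℕ} → Graph n → Subset n → Bool
isClique {n} G s = allB (λ i → allB (λ j →
  not (lookup s i ∧ lookup s j) ∨ ⌊ i ≟ j ⌋ ∨ adj G i j) (allFin n)) (allFin n)

k : {n : ℕ} → ℕ → Graph n → ℕ
k {n} t G = count (λ s → (∣ s ∣ ≡ᵇ t) ∧ isClique G s) (allSubsets n)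

degree : {n : ℕ} → Graph n → Fin n → ℕ
degree {n} G i = count (adj G i) (allFin n)

InClass : {n : ℕ} → ℕ → ℕ → Graph n → Set
InClass {n} Δ ω G =
  (∀ i → degree G i ≤ Δ) × (∀ s → isClique G s ≡ true → ∣ s ∣ ≤ ω)
  where open import Data.Product using (_×_)

private
  ≡ᵇ-refl : ∀ m → (m ≡ᵇ m) ≡ true
  ≡ᵇ-refl zero = refl
  ≡ᵇ-refl (suc m) = ≡ᵇ-refl m

  ≡ᵇ-sym : ∀ m n → (m ≡ᵇ n) ≡ (n ≡ᵇ m)
  ≡ᵇ-sym zero zero = refl
  ≡ᵇ-sym zero (suc n) = refl
  ≡ᵇ-sym (suc m) zero = refl
  ≡ᵇ-sym (suc m) (suc n) = ≡ᵇ-sym m n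

-- Turán graph T_r(n): vertex i lies in part (i mod r); adjacent iff parts differ.
-- Part sizes are ⌊n/r⌋ or ⌈n/r⌉, so they differ by at most one.
Turan : (r n : ℕ) → .{{_ : NonZero r}} → Graph n
Turan r n = record
  { adj = λ i j → not (toℕ i % r ≡ᵇ toℕ j % r)
  ; sym = λ i j → cong not (≡ᵇ-sym (toℕ i % r) (toℕ j % r))
  ; irrefl = λ i → cong not (≡ᵇ-refl (toℕ i % r))
  }

{-# OPTIONS --safe #-}
module Submission where

-- Write t = r − 2. A vertex v with neighbourhood H lies in k_t(H) cliques of size t + 1. If this is at
-- most 2t + 3 for every v, double counting suffices. Otherwise |H| = t + 3, and since H has no clique
-- of size t + 2 its complement contains two disjoint edges or a triangle. Unless H is the join of a
-- clique and a graph X on four vertices, the complement even contains 3 K₂ or K₂ ∪ P₃, and either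
-- forces k_t(H) ≤ 2t + 3. So H is such a join, X is triangle-free, and
-- k_t(H) = 4 + (t − 1) e(X) > 2t + 3 gives e(X) ≥ 3, so X is connected. The closed neighbourhood P of v
-- is the join of a t-clique and X and contains 4 + t e(X) ≤ 4(t + 1) cliques of size t + 1; by the
-- degree bound and t ≥ 3 no clique of size t + 1 meets both P and its complement. As |P| = t + 4,
-- induction on the number of vertices, deleting P, yields the density bound 4(t + 1)/(t + 4), which is
-- the density of the Turán graph.

open import Defs
open import Data.Bool using (Bool; true; false; not; _∧_; _∨_; if_then_else_)
open import Data.Bool.Properties using (T-≡; ∧-zeroʳ)
open import Data.Fin using (Fin; zero; suc; toℕ; #_; _≟_)
import Data.Fin.Properties as Fin
open import Data.Fin.Subset using (Subset; ∣_∣)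
open import Data.List using (List; []; _∷_; _++_; map; length; filterᵇ; allFin; lookup; applyUpTo; tabulate)
open import Data.List.Membership.Propositional using (_∈_; lose)
open import Data.List.Membership.Propositional.Properties using (∈-allFin)
open import Data.List.Properties
  using (filter-++; filter-notAll; length-filter; length-++; ++-assoc; ++-identityʳ;
         map-tabulate; tabulate-lookup; length-tabulate; length-applyUpTo)
open import Data.List.Relation.Binary.Permutation.Propositional using (_↭_; refl; prep; swap; ↭-sym; ↭-trans)
open import Data.List.Relation.Binary.Permutation.Propositional.Properties
  using (↭-length; filter-↭; shift; ++⁺ˡ; ++⁺ʳ; ++-comm; All-resp-↭)
open import Data.List.Relation.Binary.Sublist.Propositional using (_⊆_; []; _∷ʳ_; _∷_; ⊆-refl)
open import Data.List.Relation.Binary.Sublist.Propositional.Properties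
  using (filter⁺; filter-⊆; length-mono-≤)
open import Data.List.Relation.Unary.All as All using (All; []; _∷_)
import Data.List.Relation.Unary.All.Properties as All
open import Data.List.Relation.Unary.AllPairs using (AllPairs; []; _∷_)
import Data.List.Relation.Unary.AllPairs.Properties as AllPairs
open import Data.List.Relation.Unary.Any using (here; there)
open import Data.Nat using (ℕ; zero; suc; _+_; _*_; _∸_; _≤_; _<_; _≡ᵇ_; _≤ᵇ_; z≤n; s≤s; s≤s⁻¹; NonZero)
open import Data.Nat.DivMod using (_%_; m<n⇒m%n≡m; [m+n]%n≡m%n)
open import Data.Nat.ListAction using (sum)
open import Data.Nat.Properties hiding (_≟_)
open import Data.Nat.Tactic.RingSolver using (solve-∀)
open import Data.Product using (Σ; ∃-syntax; _×_; _,_; proj₁; proj₂)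
open import Data.Sum using (_⊎_; inj₁; inj₂; map₁; map₂)
import Data.Vec as Vec
open import Function using (_∘_; id; case_of_; Equivalence)
open import Relation.Binary.PropositionalEquality
  using (_≡_; _≢_; _≗_; refl; cong; cong₂; subst) renaming (sym to ≡-sym; trans to ≡-trans)
open import Relation.Nullary using (¬_; yes; no; contradiction)
open import Relation.Nullary.Decidable using (T?; does; ⌊_⌋)

-- Clique counts in lists of vertices

private
  variable
    A B : Set

-- Each clique is counted at its earliest vertex `x`, the rest lying among the later neighbours of
-- `x`. Entries are positions, so a repeated value stands for several vertices.
cliques : (A → A → Bool) → ℕ → List A → ℕ
cliques _~_ zero    L       = 1
cliques _~_ (suc u) []      = 0
cliques _~_ (suc u) (x ∷ L) = cliques _~_ (suc u) L + cliques _~_ u (filterᵇ (x ~_) L)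

-- Filtered lists

filterᵇ-true : (p : A → Bool) {L : List A} → All (λ x → p x ≡ true) L → filterᵇ p L ≡ L
filterᵇ-true p []         = refl
filterᵇ-true p (px ∷ pxs) rewrite px = cong (_ ∷_) (filterᵇ-true p pxs)

filterᵇ-++ : (p : A → Bool) (L M : List A) → filterᵇ p (L ++ M) ≡ filterᵇ p L ++ filterᵇ p M
filterᵇ-++ p = filter-++ (T? ∘ p)

filterᵇ-comm : (p q : A → Bool) (L : List A) → filterᵇ p (filterᵇ q L) ≡ filterᵇ q (filterᵇ p L)
filterᵇ-comm p q []      = refl
filterᵇ-comm p q (x ∷ L) with p x in px | q x in qx
... | true  | true  rewrite px | qx = cong (x ∷_) (filterᵇ-comm p q L)
... | true  | false rewrite qx      = filterᵇ-comm p q L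
... | false | true  rewrite px      = filterᵇ-comm p q L
... | false | false                 = filterᵇ-comm p q L

filterᵇ-map : (p : A → Bool) (f : B → A) (L : List B) → filterᵇ p (map f L) ≡ map f (filterᵇ (p ∘ f) L)
filterᵇ-map p f []      = refl
filterᵇ-map p f (x ∷ L) with p (f x)
... | true  = cong (f x ∷_) (filterᵇ-map p f L)
... | false = filterᵇ-map p f L

filterᵇ-∧ : (p q : A → Bool) (L : List A) → filterᵇ p (filterᵇ q L) ≡ filterᵇ (λ x → q x ∧ p x) L
filterᵇ-∧ p q []      = refl
filterᵇ-∧ p q (x ∷ L) with q x
... | false = filterᵇ-∧ p q L
... | true  with p x
...   | true  = cong (x ∷_) (filterᵇ-∧ p q L)
...   | false = filterᵇ-∧ p q L

filterᵇ-mono : {p q : A → Bool} → (∀ x → p x ≡ true → q x ≡ true) →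
               ∀ L → filterᵇ p L ⊆ filterᵇ q L
filterᵇ-mono         p⇒q []      = []
filterᵇ-mono {p = p} {q} p⇒q (x ∷ L) with p x in px | q x in qx
... | true  | true  = refl ∷ filterᵇ-mono p⇒q L
... | true  | false = case subst (_≡ true) qx (p⇒q x px) of λ ()
... | false | true  = x ∷ʳ filterᵇ-mono p⇒q L
... | false | false = filterᵇ-mono p⇒q L

filterᵇ-↭-split : (p : A → Bool) (L : List A) → L ↭ filterᵇ p L ++ filterᵇ (not ∘ p) L
filterᵇ-↭-split p []      = refl
filterᵇ-↭-split p (x ∷ L) with p x
... | true  = prep x (filterᵇ-↭-split p L)
... | false = ↭-trans (prep x (filterᵇ-↭-split p L)) (↭-sym (shift x (filterᵇ p L) _))

-- The exception is moved to the front by a permutation, so that successive case splits can name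
-- vertices one after another.
all⊎exists : (p : A → Bool) (L : List A) →
             All (λ x → p x ≡ true) L ⊎ ∃[ x ] ∃[ M ] (L ↭ x ∷ M × p x ≡ false)
all⊎exists p []      = inj₁ []
all⊎exists p (x ∷ L) with p x in px
... | false = inj₂ (x , L , refl , px)
... | true  with all⊎exists p L
...   | inj₁ all               = inj₁ (px ∷ all)
...   | inj₂ (y , M , L↭ , py) = inj₂ (y , x ∷ M , ↭-trans (prep x L↭) (swap x y refl) , py)

length-filterᵇ≤ : ∀ (p : A → Bool) L → length (filterᵇ p L) ≤ length L
length-filterᵇ≤ p = length-filter (T? ∘ p)

-- Monotonicity and size bounds for clique counts

module _ {_~_ : A → A → Bool} where

  cliques-⊆ : ∀ u {L M : List A} → L ⊆ M → cliques _~_ u L ≤ cliques _~_ u M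
  cliques-⊆ zero    _                  = ≤-refl
  cliques-⊆ (suc u) []                 = ≤-refl
  cliques-⊆ (suc u) (y ∷ʳ L⊆M)         = ≤-trans (cliques-⊆ (suc u) L⊆M) (m≤m+n _ _)
  cliques-⊆ (suc u) (_∷_ {x} refl L⊆M) =
    +-mono-≤ (cliques-⊆ (suc u) L⊆M)
             (cliques-⊆ u (filter⁺ (T? ∘ (x ~_)) (T? ∘ (x ~_)) (λ { refl → id }) L⊆M))

  cliques-filterᵇ : ∀ u (p : A → Bool) L → cliques _~_ u (filterᵇ p L) ≤ cliques _~_ u L
  cliques-filterᵇ u p L = cliques-⊆ u (filter-⊆ (T? ∘ p) L)

  cliques≡0-suc : ∀ u L → cliques _~_ u L ≡ 0 → cliques _~_ (suc u) L ≡ 0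
  cliques≡0-suc (suc u) []      _  = refl
  cliques≡0-suc (suc u) (x ∷ L) eq = cong₂ _+_
    (cliques≡0-suc (suc u) L (m+n≡0⇒m≡0 _ eq))
    (cliques≡0-suc u _ (m+n≡0⇒n≡0 (cliques _~_ (suc u) L) eq))

  cliques≡0-+ : ∀ j u L → cliques _~_ u L ≡ 0 → cliques _~_ (j + u) L ≡ 0
  cliques≡0-+ zero    u L eq = eq
  cliques≡0-+ (suc j) u L eq = cliques≡0-suc (j + u) L (cliques≡0-+ j u L eq)

  cliques-length< : ∀ u L → length L < u → cliques _~_ u L ≡ 0
  cliques-length< (suc u) []      _         = refl
  cliques-length< (suc u) (x ∷ L) (s≤s L<u) = cong₂ _+_
    (cliques-length< (suc u) L (m≤n⇒m≤1+n L<u))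
    (cliques-length< u _ (≤-trans (s≤s (length-filterᵇ≤ (x ~_) L)) L<u))

  cliques-length≤ : ∀ u L → length L ≤ u → cliques _~_ u L ≤ 1
  cliques-length≤ zero    L       _         = ≤-refl
  cliques-length≤ (suc u) []      _         = z≤n
  cliques-length≤ (suc u) (x ∷ L) (s≤s L≤u) rewrite cliques-length< (suc u) L (s≤s L≤u) =
    cliques-length≤ u _ (≤-trans (length-filterᵇ≤ (x ~_) L) L≤u)

  -- Among `suc u` vertices, a `u`-clique is determined by the single vertex that it omits.
  cliques-length≤suc : ∀ u L → length L ≤ suc u → cliques _~_ u L ≤ suc u
  cliques-length≤suc zero    L       _         = ≤-refl
  cliques-length≤suc (suc u) []      _         = z≤n
  cliques-length≤suc (suc u) (x ∷ L) (s≤s L≤u) =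
    +-mono-≤ (cliques-length≤ (suc u) L L≤u)
             (cliques-length≤suc u _ (≤-trans (length-filterᵇ≤ (x ~_) L) L≤u))

  -- An (|R|+j)-clique of R ++ X meets X in at least j vertices.
  cliques-++≡0 : ∀ j R X → cliques _~_ j X ≡ 0 → cliques _~_ (length R + j) (R ++ X) ≡ 0
  cliques-++≡0 j []      X eq = eq
  cliques-++≡0 j (x ∷ R) X eq = cong₂ _+_ (cliques≡0-suc (length R + j) (R ++ X) (cliques-++≡0 j R X eq))
    (n≤0⇒n≡0 (≤-trans (cliques-filterᵇ (length R + j) (x ~_) (R ++ X)) (≤-reflexive (cliques-++≡0 j R X eq))))

  -- At most `suc j` vertices of the clique lie in `X`, so it contains all of `R` and is determined
  -- by its trace on `X`.
  cliques-++-suc≤ : ∀ j R X → cliques _~_ (suc (suc j)) X ≡ 0 →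
                    cliques _~_ (length R + suc j) (R ++ X) ≤ cliques _~_ (suc j) X
  cliques-++-suc≤ j []      X eq = ≤-refl
  cliques-++-suc≤ j (x ∷ R) X eq
    rewrite ≡-sym (+-suc (length R) (suc j)) | cliques-++≡0 (suc (suc j)) R X eq =
    ≤-trans (cliques-filterᵇ (length R + suc j) (x ~_) (R ++ X)) (cliques-++-suc≤ j R X eq)

  -- The clique meets `X` in `j` vertices and contains all of `R`, or meets `X` in `suc j` vertices
  -- and omits exactly one of the `length R` vertices of `R`.
  cliques-++≤ : ∀ j R X → cliques _~_ (suc (suc j)) X ≡ 0 →
                cliques _~_ (length R + j) (R ++ X) ≤
                cliques _~_ j X + length R * cliques _~_ (suc j) X
  cliques-++≤ j []      X eq = m≤m+n _ _
  cliques-++≤ j (x ∷ R) X eq = begin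
    cliques _~_ (suc (length R + j)) (R ++ X) + cliques _~_ (length R + j) (filterᵇ (x ~_) (R ++ X))
      -- Omitting `x` forces all of `R` to be used, which gives `b`. For the cliques through `x`,
      -- the neighbourhood is enlarged to all of `R ++ X`.
      ≤⟨ +-mono-≤ (≤-trans (≤-reflexive (cong (λ u → cliques _~_ u (R ++ X)) (≡-sym (+-suc (length R) j))))
                           (cliques-++-suc≤ j R X eq))
                  (≤-trans (cliques-filterᵇ (length R + j) (x ~_) (R ++ X)) (cliques-++≤ j R X eq)) ⟩
    b + (a + length R * b)   ≡⟨ lemma a b (length R) ⟩
    a + suc (length R) * b   ∎
    where
    open ≤-Reasoning
    a = cliques _~_ j X
    b = cliques _~_ (suc j) X
    lemma : ∀ a b l → b + (a + l * b) ≡ a + suc l * b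
    lemma = solve-∀

  -- When `R` is complete and joined to `X`, both families counted in `cliques-++≤` really consist
  -- of cliques.
  cliques-++-join : ∀ j R X → AllPairs (λ x y → x ~ y ≡ true) R → All (λ x → All (λ y → x ~ y ≡ true) X) R →
                    cliques _~_ j X + length R * cliques _~_ (suc j) X ≤ cliques _~_ (length R + j) (R ++ X)
  cliques-++-join j [] X _ _ = ≤-reflexive (+-identityʳ _)
  cliques-++-join j (x ∷ R) X (x~R ∷ RR) (x~X ∷ RX)
    rewrite filterᵇ-true (x ~_) (All.++⁺ x~R x~X) = begin
    a + suc (length R) * b   ≡⟨ lemma a b (length R) ⟩
    b + (a + length R * b)
      ≤⟨ +-mono-≤ (≤-trans (m≤m+n b _) (cliques-++-join (suc j) R X RR RX)) (cliques-++-join j R X RR RX) ⟩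
    cliques _~_ (length R + suc j) (R ++ X) + cliques _~_ (length R + j) (R ++ X)
      ≡⟨ cong (λ u → cliques _~_ u (R ++ X) + cliques _~_ (length R + j) (R ++ X)) (+-suc (length R) j) ⟩
    cliques _~_ (suc (length R + j)) (R ++ X) + cliques _~_ (length R + j) (R ++ X) ∎
    where
    open ≤-Reasoning
    a = cliques _~_ j X
    b = cliques _~_ (suc j) X
    lemma : ∀ a b l → a + suc l * b ≡ b + (a + l * b)
    lemma = solve-∀

  -- No edge joins S to W, so a clique of S ++ X ++ W lies in S ++ X or in X ++ W.
  cliques-separated : ∀ u S X W → All (λ s → filterᵇ (s ~_) W ≡ []) S →
                      cliques _~_ u (S ++ X ++ W) ≤ cliques _~_ u (S ++ X) + cliques _~_ u (X ++ W)
  cliques-separated u       []      X W _           = m≤n+m _ _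
  cliques-separated zero    (s ∷ S) X W _           = s≤s z≤n
  cliques-separated (suc u) (s ∷ S) X W (s≁W ∷ S≁W) = begin
    cliques _~_ (suc u) (S ++ X ++ W) + cliques _~_ u (filterᵇ (s ~_) (S ++ X ++ W))
      ≤⟨ +-mono-≤ (cliques-separated (suc u) S X W S≁W) (≤-reflexive (cong (cliques _~_ u) eq)) ⟩
    a + c + b ≡⟨ lemma a c b ⟩
    a + b + c ∎
    where
    open ≤-Reasoning
    a = cliques _~_ (suc u) (S ++ X)
    b = cliques _~_ u (filterᵇ (s ~_) (S ++ X))
    c = cliques _~_ (suc u) (X ++ W)
    lemma : ∀ a c b → a + c + b ≡ a + b + c
    lemma = solve-∀
    eq : filterᵇ (s ~_) (S ++ X ++ W) ≡ filterᵇ (s ~_) (S ++ X)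
    eq = ≡-trans (cong (filterᵇ (s ~_)) (≡-sym (++-assoc S X W)))
        (≡-trans (filterᵇ-++ (s ~_) (S ++ X) W)
        (≡-trans (cong (filterᵇ (s ~_) (S ++ X) ++_) s≁W) (++-identityʳ _)))

-- Relabelling and comparison of graphs

cliques-map : {_~_ : A → A → Bool} (f : B → A) → ∀ u L →
              cliques _~_ u (map f L) ≡ cliques (λ i j → f i ~ f j) u L
cliques-map f zero    L       = refl
cliques-map f (suc u) []      = refl
cliques-map {_~_ = _~_} f (suc u) (x ∷ L) = cong₂ _+_ (cliques-map f (suc u) L)
  (≡-trans (cong (cliques _~_ u) (filterᵇ-map (f x ~_) f L)) (cliques-map f u _))

cliques-mono : {_~_ _≈_ : A → A → Bool} → (∀ i j → i ~ j ≡ true → i ≈ j ≡ true) →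
               ∀ u L → cliques _~_ u L ≤ cliques _≈_ u L
cliques-mono hom zero    L       = ≤-refl
cliques-mono hom (suc u) []      = ≤-refl
cliques-mono {_~_ = _~_} hom (suc u) (x ∷ L) = +-mono-≤ (cliques-mono hom (suc u) L)
  (≤-trans (cliques-mono hom u (filterᵇ (x ~_) L)) (cliques-⊆ u (filterᵇ-mono (hom x) L)))

sum-map-≤ : ∀ {f : A → ℕ} {b L} → All (λ x → f x ≤ b) L → sum (map f L) ≤ length L * b
sum-map-≤ []       = z≤n
sum-map-≤ (fx ∷ f) = +-mono-≤ fx (sum-map-≤ f)

filterᵇ-all : ∀ (p : A → Bool) L → All (λ x → p x ≡ true) (filterᵇ p L)
filterᵇ-all p []      = []
filterᵇ-all p (x ∷ L) with p x in px
... | true  = px ∷ filterᵇ-all p L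
... | false = filterᵇ-all p L

-- With the slack `k` written out, a polynomial inequality becomes an identity for the ring solver.
≤-by : ∀ {m n} k → m + k ≡ n → m ≤ n
≤-by k refl = m≤m+n _ k

-- The complete graph minus the edges E: by monotonicity, its clique numbers, which evaluate, bound those
-- of any graph in which the pairs in E are non-adjacent.
avoiding : ∀ {m} → List (Fin m × Fin m) → Fin m → Fin m → Bool
avoiding []            i j = true
avoiding ((a , b) ∷ E) i j =
  not (does (i ≟ a) ∧ does (j ≟ b) ∨ does (i ≟ b) ∧ does (j ≟ a)) ∧ avoiding E i j

-- Independence of the vertex order

module SymmetricGraph (_~_ : A → A → Bool) (~-sym : ∀ x y → x ~ y ≡ y ~ x) (~-irrefl : ∀ x → x ~ x ≡ false) where

  Complete : List A → Set
  Complete = AllPairs (λ x y → x ~ y ≡ true)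

  Joined : List A → List A → Set
  Joined R X = All (λ x → All (λ y → x ~ y ≡ true) X) R

  -- Cliques through both vertices come from the common neighbourhood whichever vertex is first,
  -- because the filters commute; the remaining terms trade places.
  cliques-swap : ∀ u x y M → cliques _~_ u (x ∷ y ∷ M) ≡ cliques _~_ u (y ∷ x ∷ M)
  cliques-swap zero          x y M = refl
  cliques-swap (suc zero)    x y M = refl
  cliques-swap (suc (suc u)) x y M rewrite ~-sym y x with x ~ y
  ... | false = lemma (cliques _~_ (suc (suc u)) M) _ _
    where
    lemma : ∀ a b c → a + b + c ≡ a + c + b
    lemma = solve-∀
  ... | true rewrite filterᵇ-comm (y ~_) (x ~_) M = lemma (cliques _~_ (suc (suc u)) M) _ _ _
    where
    lemma : ∀ a b c d → a + b + (c + d) ≡ a + c + (b + d)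
    lemma = solve-∀

  cliques-↭ : ∀ u {L M} → L ↭ M → cliques _~_ u L ≡ cliques _~_ u M
  cliques-↭ zero    _                 = refl
  cliques-↭ (suc u) refl              = refl
  cliques-↭ (suc u) (_↭_.trans p q)   = ≡-trans (cliques-↭ (suc u) p) (cliques-↭ (suc u) q)
  cliques-↭ (suc u) (prep x L↭M)      =
    cong₂ _+_ (cliques-↭ (suc u) L↭M) (cliques-↭ u (filter-↭ (T? ∘ (x ~_)) L↭M))
  cliques-↭ (suc u) {M = _ ∷ _ ∷ M} (swap x y L↭M) = ≡-trans
    (cong₂ _+_ (cong₂ _+_ (cliques-↭ (suc u) L↭M) (cliques-↭ u (filter-↭ (T? ∘ (y ~_)) L↭M)))
               (cliques-↭ u (filter-↭ (T? ∘ (x ~_)) (prep y L↭M))))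
    (cliques-swap (suc u) x y M)

  length-filterᵇ-↭ : ∀ (p : A → Bool) {L M} → L ↭ M → length (filterᵇ p L) ≡ length (filterᵇ p M)
  length-filterᵇ-↭ p L↭M = ↭-length (filter-↭ (T? ∘ p) L↭M)

  avoiding-hom : ∀ X {E} → All (λ (a , b) → lookup X a ~ lookup X b ≡ false) E →
                 ∀ i j → lookup X i ~ lookup X j ≡ true → avoiding E i j ≡ true
  avoiding-hom X []                    i j i~j = refl
  avoiding-hom X (_∷_ {a , b} a≁b E≁) i j i~j rewrite avoiding-hom X E≁ i j i~j
    with i ≟ a | j ≟ b | i ≟ b | j ≟ a
  ... | yes refl | yes refl | _        | _        = contradiction (≡-trans (≡-sym i~j) a≁b) λ ()
  ... | no _     | _        | yes refl | yes refl =
    contradiction (≡-trans (≡-sym i~j) (≡-trans (~-sym (lookup X b) (lookup X a)) a≁b)) λ ()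
  ... | yes refl | no _     | yes refl | yes refl =
    contradiction (≡-trans (≡-sym i~j) (≡-trans (~-sym (lookup X b) (lookup X a)) a≁b)) λ ()
  ... | no _     | _        | no _     | _        = refl
  ... | no _     | _        | yes _    | no _     = refl
  ... | yes _    | no _     | no _     | _        = refl
  ... | yes _    | no _     | yes _    | no _     = refl

  cliques-avoiding : ∀ u X {E} → All (λ (a , b) → lookup X a ~ lookup X b ≡ false) E →
                     cliques _~_ u X ≤ cliques (avoiding E) u (allFin (length X))
  cliques-avoiding u X {E} E≁ = begin
    cliques _~_ u X                                    ≡⟨ cong (cliques _~_ u) X≡ ⟩
    cliques _~_ u (map (lookup X) (allFin (length X))) ≡⟨ cliques-map (lookup X) u _ ⟩
    _                                                  ≤⟨ cliques-mono (avoiding-hom X E≁) u _ ⟩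
    cliques (avoiding E) u (allFin (length X))         ∎
    where
    open ≤-Reasoning
    X≡ : X ≡ map (lookup X) (allFin (length X))
    X≡ = ≡-sym (≡-trans (map-tabulate id (lookup X)) (tabulate-lookup X))

  -- Double counting over neighbourhoods

  -- Adding `x` to the ambient list gives each neighbour `v` of `x` the extra cliques through `x`,
  -- found in the common neighbourhood. Keeping `L` apart from `M` lets the induction run on `L`
  -- alone.
  sum-cliques-∷ : ∀ u x L M →
    sum (map (λ v → cliques _~_ (suc u) (filterᵇ (v ~_) (x ∷ M))) L) ≡
    sum (map (λ v → cliques _~_ (suc u) (filterᵇ (v ~_) M)) L) +
    sum (map (λ v → cliques _~_ u (filterᵇ (v ~_) (filterᵇ (x ~_) M))) (filterᵇ (x ~_) L))
  sum-cliques-∷ u x []      M = refl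
  sum-cliques-∷ u x (v ∷ L) M rewrite ~-sym v x | sum-cliques-∷ u x L M with x ~ v
  ... | false = ≡-sym (+-assoc (cliques _~_ (suc u) (filterᵇ (v ~_) M)) _ _)
  ... | true  rewrite filterᵇ-comm (v ~_) (x ~_) M =
    swap-mid (cliques _~_ (suc u) (filterᵇ (v ~_) M)) _ _ _
    where
    swap-mid : ∀ a b c d → a + b + (c + d) ≡ a + c + (b + d)
    swap-mid = solve-∀

  filterᵇ-self : ∀ x M → filterᵇ (x ~_) (x ∷ M) ≡ filterᵇ (x ~_) M
  filterᵇ-self x M rewrite ~-irrefl x = refl

  -- Each clique of size `suc u` is seen once from each of its vertices.
  sum-cliques-neighbourhood : ∀ u L →
    sum (map (λ v → cliques _~_ u (filterᵇ (v ~_) L)) L) ≡ suc u * cliques _~_ (suc u) L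
  sum-cliques-neighbourhood zero    L = go L L
    where
    go : ∀ L M → sum (map (λ v → cliques _~_ 0 (filterᵇ (v ~_) M)) L) ≡ 1 * cliques _~_ 1 L
    go []      M = refl
    go (x ∷ L) M rewrite go L M = lemma (cliques _~_ 1 L)
      where
      lemma : ∀ a → 1 + 1 * a ≡ 1 * (a + 1)
      lemma = solve-∀
  sum-cliques-neighbourhood (suc u) []      = ≡-sym (*-zeroʳ u)
  sum-cliques-neighbourhood (suc u) (x ∷ M) = ≡-trans
    -- The cliques through `x` are seen once from `x` and, by induction inside its neighbourhood,
    -- `suc u` times from their other vertices.
    (cong₂ _+_ (cong (cliques _~_ (suc u)) (filterᵇ-self x M))
               (≡-trans (sum-cliques-∷ u x M M)
                        (cong₂ _+_ (sum-cliques-neighbourhood (suc u) M)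
                                   (sum-cliques-neighbourhood u (filterᵇ (x ~_) M)))))
    (lemma u (cliques _~_ (suc u) (filterᵇ (x ~_) M)) (cliques _~_ (suc (suc u)) M))
    where
    lemma : ∀ u a b → a + (suc (suc u) * b + suc u * a) ≡ suc (suc u) * (b + a)
    lemma = solve-∀

  -- Non-edges of a neighbourhood

  complete⊎nonadjacent : ∀ L → Complete L ⊎ ∃[ a ] ∃[ b ] ∃[ M ] (L ↭ a ∷ b ∷ M × a ~ b ≡ false)
  complete⊎nonadjacent []      = inj₁ []
  complete⊎nonadjacent (x ∷ L) with all⊎exists (x ~_) L | complete⊎nonadjacent L
  ... | inj₂ (y , M , L↭ , x≁y) | _       = inj₂ (x , y , M , prep x L↭ , x≁y)
  ... | inj₁ x~L                | inj₁ LL = inj₁ (x~L ∷ LL)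
  ... | inj₁ _ | inj₂ (a , b , M , L↭ , a≁b) =
    inj₂ (a , b , x ∷ M , ↭-trans (prep x L↭) (↭-trans (swap x a refl) (prep a (swap x b refl))) , a≁b)

  complete⇒cliques : ∀ L → Complete L → 1 ≤ cliques _~_ (length L) L
  complete⇒cliques []      _          = ≤-refl
  complete⇒cliques (x ∷ L) (x~L ∷ LL) rewrite filterᵇ-true (x ~_) x~L =
    ≤-trans (complete⇒cliques L LL) (m≤n+m _ _)

  incomplete : ∀ {m x L H} → H ↭ x ∷ L → length H ≡ suc m → cliques _~_ m H ≡ 0 → ¬ Complete L
  incomplete {m} {x} {L} {H} H↭ |H| none complete = contradiction (begin
    1                           ≤⟨ complete⇒cliques L complete ⟩
    cliques _~_ (length L) L    ≡⟨ cong (λ u → cliques _~_ u L) |L| ⟩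
    cliques _~_ m L             ≤⟨ cliques-⊆ m (x ∷ʳ ⊆-refl) ⟩
    cliques _~_ m (x ∷ L)       ≡⟨ cliques-↭ m H↭ ⟨
    cliques _~_ m H             ≡⟨ none ⟩
    0                           ∎) λ ()
    where
    open ≤-Reasoning
    |L| : length L ≡ m
    |L| = suc-injective (≡-trans (≡-sym (↭-length H↭)) |H|)

  NonEdges : (X : List A) → List (Fin (length X) × Fin (length X)) → Set
  NonEdges X = All (λ (a , b) → lookup X a ~ lookup X b ≡ false)

  -- These are the minimal sets of non-edges that no single vertex covers.
  data CoTwoEdges (H : List A) : Set where
    disjoint : ∀ a b c d R → H ↭ a ∷ b ∷ c ∷ d ∷ R → a ~ b ≡ false → c ~ d ≡ false → CoTwoEdges H
    triangle : ∀ a b c R → H ↭ a ∷ b ∷ c ∷ R → a ~ b ≡ false → b ~ c ≡ false → a ~ c ≡ false → CoTwoEdges H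

  -- No single vertex covers all non-edges: deleting it would leave a clique on m vertices.
  coTwoEdges : ∀ {m} H → length H ≡ suc m → cliques _~_ m H ≡ 0 → CoTwoEdges H
  coTwoEdges (x ∷ L) |H| none with complete⊎nonadjacent L
  ... | inj₁ complete = contradiction complete (incomplete refl |H| none)
  ... | inj₂ (a , b , M , L↭ , a≁b) with complete⊎nonadjacent (x ∷ M)
  ...   | inj₂ (c , d , R , xM↭ , c≁d) =
    disjoint a b c d R (↭-trans (prep x L↭) (↭-trans (swap x a refl) (prep a (↭-trans (swap x b refl) (prep b xM↭))))) a≁b c≁d
  -- Now `x ∷ M` is a clique, so every non-edge meets `a` or `b`. A non-neighbour `c` of `a` either
  -- misses `b` as well, closing a triangle, or `b` has another non-neighbour `d`.
  ...   | inj₁ complete with all⊎exists (a ~_) (x ∷ M)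
  ...     | inj₁ a~ = contradiction (a~ ∷ complete)
    (incomplete (↭-trans (prep x L↭) (↭-trans (swap x a refl) (↭-trans (prep a (swap x b refl)) (swap a b refl)))) |H| none)
  ...     | inj₂ (c , R , xM↭ , a≁c) with b ~ c in b~c
  ...       | false = triangle a b c R
    (↭-trans (prep x L↭) (↭-trans (swap x a refl) (prep a (↭-trans (swap x b refl) (prep b xM↭))))) a≁b b~c a≁c
  ...       | true with all⊎exists (b ~_) R
  ...         | inj₁ b~ = contradiction (All-resp-↭ (↭-sym xM↭) (b~c ∷ b~) ∷ complete)
    (incomplete (↭-trans (prep x L↭) (↭-trans (swap x a refl) (prep a (swap x b refl)))) |H| none)
  ...         | inj₂ (d , Q , R↭ , b≁d) =
    disjoint a c b d Q (↭-trans (prep x L↭) (↭-trans (swap x a refl) (prep a (↭-trans (swap x b refl)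
      (↭-trans (prep b (↭-trans xM↭ (prep c R↭))) (swap b c refl)))))) a≁c b≁d

  -- Both `H` over `t` and `X` over `j` have excess `k`, so `t - j` vertices lie outside `X`, and
  -- `cliques-++≤` applies. Returning `t` as `l + j` lets callers match on `refl` and obtain a bound
  -- linear in `l`.
  cliques-nonEdges : ∀ k j {t H} X R {E} → length H ≡ k + t → length X ≡ k + j → H ↭ X ++ R → NonEdges X E →
    cliques (avoiding E) (suc (suc j)) (allFin (length X)) ≡ 0 →
    ∃[ l ] (t ≡ l + j × cliques _~_ t H ≤ cliques (avoiding E) j (allFin (length X)) +
                                          l * cliques (avoiding E) (suc j) (allFin (length X)))
  cliques-nonEdges k j {t} {H} X R {E} |H| |X| H↭ E≁ none = length R , t≡ , (begin
    cliques _~_ t H                                    ≡⟨ cliques-↭ t (↭-trans H↭ (++-comm X R)) ⟩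
    cliques _~_ t (R ++ X)                             ≡⟨ cong (λ u → cliques _~_ u (R ++ X)) t≡ ⟩
    cliques _~_ (length R + j) (R ++ X)                ≤⟨ cliques-++≤ j R X none′ ⟩
    cliques _~_ j X + length R * cliques _~_ (suc j) X
      ≤⟨ +-mono-≤ (cliques-avoiding j X E≁) (*-monoʳ-≤ (length R) (cliques-avoiding (suc j) X E≁)) ⟩
    cliques (avoiding E) j (allFin (length X)) + length R * cliques (avoiding E) (suc j) (allFin (length X)) ∎)
    where
    open ≤-Reasoning
    none′ : cliques _~_ (suc (suc j)) X ≡ 0
    none′ = n≤0⇒n≡0 (≤-trans (cliques-avoiding (suc (suc j)) X E≁) (≤-reflexive none))
    t≡ : t ≡ length R + j
    t≡ = +-cancelˡ-≡ k t (length R + j) (begin-equality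
      k + t               ≡⟨ |H| ⟨
      length H            ≡⟨ ↭-length H↭ ⟩
      length (X ++ R)     ≡⟨ length-++ X ⟩
      length X + length R ≡⟨ cong (_+ length R) |X| ⟩
      k + j + length R    ≡⟨ lemma k j (length R) ⟩
      k + (length R + j)  ∎)
      where
      lemma : ∀ k j l → k + j + l ≡ k + (l + j)
      lemma = solve-∀

  -- By the last four fields X is connected: p is joined to q and q′, and y to one of these three.
  record Reducible (H : List A) : Set where
    field
      R        : List A
      p q q′ y : A
    X : List A
    X = p ∷ q ∷ q′ ∷ y ∷ []
    field
      H↭         : H ↭ R ++ X
      R-complete : Complete R
      R-joined-X : Joined R X
      X-edges    : cliques _~_ 2 X ≤ 4
      X-triangle : cliques _~_ 3 X ≡ 0
      p~q        : p ~ q ≡ true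
      p~q′       : p ~ q′ ≡ true
      q≁q′       : q ~ q′ ≡ false
      y~         : 1 ≤ length (filterᵇ (y ~_) (p ∷ q ∷ q′ ∷ []))

  joined₄ : ∀ {R a b c d} → All (λ x → a ~ x ≡ true) R → All (λ x → b ~ x ≡ true) R →
            All (λ x → c ~ x ≡ true) R → All (λ x → d ~ x ≡ true) R → Joined R (a ∷ b ∷ c ∷ d ∷ [])
  joined₄ []        []        []        []        = []
  joined₄ (a ∷ as) (b ∷ bs) (c ∷ cs) (d ∷ ds) =
    (≡-trans (~-sym _ _) a ∷ ≡-trans (~-sym _ _) b ∷ ≡-trans (~-sym _ _) c ∷ ≡-trans (~-sym _ _) d ∷ [])
    ∷ joined₄ as bs cs ds

  -- `K₄` minus two disjoint edges is a four-cycle, hence at most four edges and no triangle. The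
  -- vertex `c` plays `p`, its neighbours `a` and `b` play `q` and `q′`, and `d` plays `y`.
  reducible : ∀ {H} a b c d R → H ↭ a ∷ b ∷ c ∷ d ∷ R →
         a ~ b ≡ false → c ~ d ≡ false →
         Complete R → Joined R (a ∷ b ∷ c ∷ d ∷ []) →
         c ~ a ≡ true → c ~ b ≡ true → 1 ≤ length (filterᵇ (d ~_) (c ∷ a ∷ b ∷ [])) → Reducible H
  reducible a b c d R H↭ a≁b c≁d RR RX c~a c~b d~ = record
    { R          = R
    ; H↭         = ↭-trans H↭ (↭-trans (++-comm (a ∷ b ∷ c ∷ d ∷ []) R) (++⁺ˡ R order))
    ; R-complete = RR
    ; R-joined-X = All.map (All-resp-↭ order) RX
    ; X-edges    = cliques-avoiding 2 (c ∷ a ∷ b ∷ d ∷ []) nonEdges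
    ; X-triangle = n≤0⇒n≡0 (cliques-avoiding 3 (c ∷ a ∷ b ∷ d ∷ []) nonEdges)
    ; p~q        = c~a
    ; p~q′       = c~b
    ; q≁q′       = a≁b
    ; y~         = d~
    }
    where
    order : a ∷ b ∷ c ∷ d ∷ [] ↭ c ∷ a ∷ b ∷ d ∷ []
    order = ↭-trans (prep a (swap b c refl)) (swap a c refl)
    nonEdges : NonEdges (c ∷ a ∷ b ∷ d ∷ []) ((# 1 , # 2) ∷ (# 0 , # 3) ∷ [])
    nonEdges = a≁b ∷ c≁d ∷ []

  -- Non-edge patterns that force few cliques

  -- `K₆` minus three disjoint edges is the octahedron, with 8 triangles and no `K₄`; here
  -- `t = l + 3`.
  few-disjointEdges : ∀ {t H} a b c d e f R → length H ≡ 3 + t → H ↭ a ∷ b ∷ c ∷ d ∷ e ∷ f ∷ R →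
    a ~ b ≡ false → c ~ d ≡ false → e ~ f ≡ false → cliques _~_ t H ≤ 3 + 2 * t
  few-disjointEdges a b c d e f R |H| H↭ a≁b c≁d e≁f
    with cliques-nonEdges 3 3 (a ∷ b ∷ c ∷ d ∷ e ∷ f ∷ []) R {(# 0 , # 1) ∷ (# 2 , # 3) ∷ (# 4 , # 5) ∷ []}
           |H| refl H↭ (a≁b ∷ c≁d ∷ e≁f ∷ []) refl
  ... | l , refl , H≤ = ≤-trans H≤ (≤-by (1 + 2 * l) (lemma l))
    where
    lemma : ∀ l → 8 + l * 0 + (1 + 2 * l) ≡ 3 + 2 * (l + 3)
    lemma = solve-∀

  -- The pattern is `K₅` minus `K₂ ∪ P₃`: 7 edges, 2 triangles and no `K₄`. With `t = l + 2` the
  -- bound is exactly `3 + 2 * t`, without slack.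
  few-fiveVertices : ∀ {t H} a b c d e R {E} → length H ≡ 3 + t → H ↭ a ∷ b ∷ c ∷ d ∷ e ∷ R →
    NonEdges (a ∷ b ∷ c ∷ d ∷ e ∷ []) E →
    cliques (avoiding E) 2 (allFin 5) ≡ 7 → cliques (avoiding E) 3 (allFin 5) ≡ 2 →
    cliques (avoiding E) 4 (allFin 5) ≡ 0 → cliques _~_ t H ≤ 3 + 2 * t
  few-fiveVertices a b c d e R |H| H↭ E≁ edges triangles none
    with cliques-nonEdges 3 2 (a ∷ b ∷ c ∷ d ∷ e ∷ []) R |H| refl H↭ E≁ none
  ... | l , refl , H≤ rewrite edges | triangles = ≤-trans H≤ (≤-reflexive (lemma l))
    where
    lemma : ∀ l → 7 + l * 2 ≡ 3 + 2 * (l + 2)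
    lemma = solve-∀

  -- This treats four vertices spanning at most two edges; here `t = l + 1`.
  few-fourVertices : ∀ {t H} a b c d R {E} → length H ≡ 3 + t → H ↭ a ∷ b ∷ c ∷ d ∷ R →
    NonEdges (a ∷ b ∷ c ∷ d ∷ []) E →
    cliques (avoiding E) 1 (allFin 4) ≡ 4 → cliques (avoiding E) 2 (allFin 4) ≡ 2 →
    cliques (avoiding E) 3 (allFin 4) ≡ 0 → cliques _~_ t H ≤ 3 + 2 * t
  few-fourVertices a b c d R |H| H↭ E≁ vertices edges none
    with cliques-nonEdges 3 1 (a ∷ b ∷ c ∷ d ∷ []) R |H| refl H↭ E≁ none
  ... | l , refl , H≤ rewrite vertices | edges = ≤-trans H≤ (≤-by 1 (lemma l))
    where
    lemma : ∀ l → 4 + l * 2 + 1 ≡ 3 + 2 * (l + 1)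
    lemma = solve-∀

  nonempty-filterᵇ : ∀ (p : A → Bool) L i → p (lookup L i) ≡ true → 1 ≤ length (filterᵇ p L)
  nonempty-filterᵇ p (x ∷ L) zero    px rewrite px = s≤s z≤n
  nonempty-filterᵇ p (x ∷ L) (suc i) pi with p x
  ... | true  = s≤s z≤n
  ... | false = nonempty-filterᵇ p L i pi

  -- Classification of neighbourhoods

  -- The undecided pairs `ca`, `cb`, `da`, `db` form a four-cycle. If at least three are edges, then
  -- `c` or `d` is adjacent to both `a` and `b`, and the remaining vertex is attached too. If two
  -- are missing, at most two edges survive.
  classify-dominated : ∀ {t H} → length H ≡ 3 + t → ∀ a b c d R → H ↭ a ∷ b ∷ c ∷ d ∷ R →
                       a ~ b ≡ false → c ~ d ≡ false → Complete R → Joined R (a ∷ b ∷ c ∷ d ∷ []) →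
                       cliques _~_ t H ≤ 3 + 2 * t ⊎ Reducible H
  classify-dominated {t} {H} |H| a b c d R H↭ a≁b c≁d RR RX = go refl refl refl refl
    where
    c-centre : c ~ a ≡ true → c ~ b ≡ true → 1 ≤ length (filterᵇ (d ~_) (c ∷ a ∷ b ∷ [])) → Reducible H
    c-centre = reducible a b c d R H↭ a≁b c≁d RR RX

    cd↭ : ∀ {L} → a ∷ b ∷ c ∷ d ∷ L ↭ a ∷ b ∷ d ∷ c ∷ L
    cd↭ = prep a (prep b (swap c d refl))

    d-centre : d ~ a ≡ true → d ~ b ≡ true → 1 ≤ length (filterᵇ (c ~_) (d ∷ a ∷ b ∷ [])) → Reducible H
    d-centre = reducible a b d c R (↭-trans H↭ cd↭) a≁b (≡-trans (~-sym d c) c≁d) RR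
      (All.map (All-resp-↭ cd↭) RX)

    few : ∀ E → NonEdges (a ∷ b ∷ c ∷ d ∷ []) E → cliques (avoiding E) 1 (allFin 4) ≡ 4 →
          cliques (avoiding E) 2 (allFin 4) ≡ 2 → cliques (avoiding E) 3 (allFin 4) ≡ 0 →
          cliques _~_ t H ≤ 3 + 2 * t
    few E E≁ = few-fourVertices a b c d R |H| H↭ E≁

    go : ∀ {ca cb da db} → c ~ a ≡ ca → c ~ b ≡ cb → d ~ a ≡ da → d ~ b ≡ db →
         cliques _~_ t H ≤ 3 + 2 * t ⊎ Reducible H
    go {true}  {true}  {true}  {_}     ca cb da db = inj₂ (c-centre ca cb (nonempty-filterᵇ (d ~_) (c ∷ a ∷ b ∷ []) (# 1) da))
    go {true}  {true}  {false} {true}  ca cb da db = inj₂ (c-centre ca cb (nonempty-filterᵇ (d ~_) (c ∷ a ∷ b ∷ []) (# 2) db))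
    go {true}  {false} {true}  {true}  ca cb da db = inj₂ (d-centre da db (nonempty-filterᵇ (c ~_) (d ∷ a ∷ b ∷ []) (# 1) ca))
    go {false} {true}  {true}  {true}  ca cb da db = inj₂ (d-centre da db (nonempty-filterᵇ (c ~_) (d ∷ a ∷ b ∷ []) (# 2) cb))
    go {_}     {_}     {false} {false} ca cb da db =
      inj₁ (few ((# 0 , # 1) ∷ (# 2 , # 3) ∷ (# 3 , # 0) ∷ (# 3 , # 1) ∷ []) (a≁b ∷ c≁d ∷ da ∷ db ∷ []) refl refl refl)
    go {false} {false} {_}     {_}     ca cb da db =
      inj₁ (few ((# 0 , # 1) ∷ (# 2 , # 3) ∷ (# 2 , # 0) ∷ (# 2 , # 1) ∷ []) (a≁b ∷ c≁d ∷ ca ∷ cb ∷ []) refl refl refl)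
    go {false} {_}     {false} {_}     ca cb da db =
      inj₁ (few ((# 0 , # 1) ∷ (# 2 , # 3) ∷ (# 2 , # 0) ∷ (# 3 , # 0) ∷ []) (a≁b ∷ c≁d ∷ ca ∷ da ∷ []) refl refl refl)
    go {false} {_}     {_}     {false} ca cb da db =
      inj₁ (few ((# 0 , # 1) ∷ (# 2 , # 3) ∷ (# 2 , # 0) ∷ (# 3 , # 1) ∷ []) (a≁b ∷ c≁d ∷ ca ∷ db ∷ []) refl refl refl)
    go {_}     {false} {false} {_}     ca cb da db =
      inj₁ (few ((# 0 , # 1) ∷ (# 2 , # 3) ∷ (# 2 , # 1) ∷ (# 3 , # 0) ∷ []) (a≁b ∷ c≁d ∷ cb ∷ da ∷ []) refl refl refl)
    go {_}     {false} {_}     {false} ca cb da db =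
      inj₁ (few ((# 0 , # 1) ∷ (# 2 , # 3) ∷ (# 2 , # 1) ∷ (# 3 , # 1) ∷ []) (a≁b ∷ c≁d ∷ cb ∷ db ∷ []) refl refl refl)

  -- A non-edge inside `R` completes three disjoint non-edges, and one from `R` to the four vertices
  -- completes `K₂ ∪ P₃`. Otherwise `R` is a clique joined to them.
  classify-disjoint : ∀ {t H} → length H ≡ 3 + t → ∀ a b c d R → H ↭ a ∷ b ∷ c ∷ d ∷ R →
                      a ~ b ≡ false → c ~ d ≡ false → cliques _~_ t H ≤ 3 + 2 * t ⊎ Reducible H
  classify-disjoint {t} {H} |H| a b c d R H↭ a≁b c≁d with complete⊎nonadjacent R
  ... | inj₂ (e , f , Q , R↭ , e≁f) = inj₁ (few-disjointEdges a b c d e f Q |H|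
    (↭-trans H↭ (prep a (prep b (prep c (prep d R↭))))) a≁b c≁d e≁f)
  ... | inj₁ RR with all⊎exists (a ~_) R | all⊎exists (b ~_) R | all⊎exists (c ~_) R | all⊎exists (d ~_) R
  ...   | inj₂ (e , Q , R↭ , a≁e) | _ | _ | _ = inj₁ (few-fiveVertices a b c d e Q
    {(# 0 , # 1) ∷ (# 2 , # 3) ∷ (# 0 , # 4) ∷ []} |H| (↭-trans H↭ (prep a (prep b (prep c (prep d R↭)))))
    (a≁b ∷ c≁d ∷ a≁e ∷ []) refl refl refl)
  ...   | _ | inj₂ (e , Q , R↭ , b≁e) | _ | _ = inj₁ (few-fiveVertices a b c d e Q
    {(# 0 , # 1) ∷ (# 2 , # 3) ∷ (# 1 , # 4) ∷ []} |H| (↭-trans H↭ (prep a (prep b (prep c (prep d R↭)))))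
    (a≁b ∷ c≁d ∷ b≁e ∷ []) refl refl refl)
  ...   | _ | _ | inj₂ (e , Q , R↭ , c≁e) | _ = inj₁ (few-fiveVertices a b c d e Q
    {(# 0 , # 1) ∷ (# 2 , # 3) ∷ (# 2 , # 4) ∷ []} |H| (↭-trans H↭ (prep a (prep b (prep c (prep d R↭)))))
    (a≁b ∷ c≁d ∷ c≁e ∷ []) refl refl refl)
  ...   | _ | _ | _ | inj₂ (e , Q , R↭ , d≁e) = inj₁ (few-fiveVertices a b c d e Q
    {(# 0 , # 1) ∷ (# 2 , # 3) ∷ (# 3 , # 4) ∷ []} |H| (↭-trans H↭ (prep a (prep b (prep c (prep d R↭)))))
    (a≁b ∷ c≁d ∷ d≁e ∷ []) refl refl refl)
  ...   | inj₁ a~R | inj₁ b~R | inj₁ c~R | inj₁ d~R =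
    classify-dominated |H| a b c d R H↭ a≁b c≁d RR (joined₄ a~R b~R c~R d~R)

  -- Any non-edge meeting `R` is disjoint from some side of the triangle, which reduces to
  -- `classify-disjoint`. Otherwise all non-edges lie in the triangle, and a vertex of `R` serves as
  -- the fourth vertex of `X`.
  classify-triangle : ∀ {t H} → 1 ≤ t → length H ≡ 3 + t → ∀ a b c R → H ↭ a ∷ b ∷ c ∷ R →
                      a ~ b ≡ false → b ~ c ≡ false → a ~ c ≡ false → cliques _~_ t H ≤ 3 + 2 * t ⊎ Reducible H
  classify-triangle {t} {H} 1≤t |H| a b c R H↭ a≁b b≁c a≁c with complete⊎nonadjacent R
  ... | inj₂ (e , f , Q , R↭ , e≁f) = classify-disjoint |H| a b e f (c ∷ Q)
    (↭-trans H↭ (prep a (prep b (↭-trans (prep c R↭) (↭-trans (swap c e refl) (prep e (swap c f refl))))))) a≁b e≁f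
  ... | inj₁ RR with all⊎exists (a ~_) R | all⊎exists (b ~_) R | all⊎exists (c ~_) R
  ...   | inj₂ (e , Q , R↭ , a≁e) | _ | _ = classify-disjoint |H| a e b c Q
    (↭-trans H↭ (prep a (↭-trans (prep b (↭-trans (prep c R↭) (swap c e refl))) (swap b e refl)))) a≁e b≁c
  ...   | _ | inj₂ (e , Q , R↭ , b≁e) | _ = classify-disjoint |H| b e a c Q
    (↭-trans H↭ (↭-trans (swap a b refl) (prep b (↭-trans (prep a (↭-trans (prep c R↭) (swap c e refl))) (swap a e refl)))))
    b≁e a≁c
  ...   | _ | _ | inj₂ (e , Q , R↭ , c≁e) = classify-disjoint |H| a b c e Q
    (↭-trans H↭ (prep a (prep b (prep c R↭)))) a≁b c≁e
  -- The list `R` has `t` entries, so `1 ≤ t` excludes the empty case.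
  classify-triangle 1≤t |H| a b c [] H↭ _ _ _ | inj₁ _ | _ | _ | _ =
    contradiction (≡-trans (≡-sym |H|) (↭-length H↭)) (λ eq → <⇒≢ 1≤t (≡-sym (+-cancelˡ-≡ 3 _ 0 eq)))
  -- Here `X` is the star with centre `e` and leaves `a`, `b`, `c`.
  classify-triangle 1≤t |H| a b c (e ∷ R) H↭ a≁b b≁c a≁c | inj₁ (e~R ∷ RR)
    | inj₁ (a~e ∷ a~R) | inj₁ (b~e ∷ b~R) | inj₁ (c~e ∷ c~R) = inj₂ record
    { R          = R
    ; H↭         = ↭-trans H↭ (↭-trans (++-comm (a ∷ b ∷ c ∷ e ∷ []) R) (++⁺ˡ R order))
    ; R-complete = RR
    ; R-joined-X = joined₄ e~R a~R b~R c~R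
    ; X-edges    = ≤-trans (cliques-avoiding 2 (e ∷ a ∷ b ∷ c ∷ []) nonEdges) (n≤1+n 3)
    ; X-triangle = n≤0⇒n≡0 (cliques-avoiding 3 (e ∷ a ∷ b ∷ c ∷ []) nonEdges)
    ; p~q        = ≡-trans (~-sym e a) a~e
    ; p~q′       = ≡-trans (~-sym e b) b~e
    ; q≁q′       = a≁b
    ; y~         = nonempty-filterᵇ (c ~_) (e ∷ a ∷ b ∷ []) (# 0) c~e
    }
    where
    order : a ∷ b ∷ c ∷ e ∷ [] ↭ e ∷ a ∷ b ∷ c ∷ []
    order = ++-comm (a ∷ b ∷ c ∷ []) (e ∷ [])
    nonEdges : NonEdges (e ∷ a ∷ b ∷ c ∷ []) ((# 1 , # 2) ∷ (# 2 , # 3) ∷ (# 1 , # 3) ∷ [])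
    nonEdges = a≁b ∷ b≁c ∷ a≁c ∷ []

  classify : ∀ {t} H → 1 ≤ t → length H ≤ 3 + t → cliques _~_ (2 + t) H ≡ 0 →
             cliques _~_ t H ≤ 3 + 2 * t ⊎ (length H ≡ 3 + t × Reducible H)
  classify {t} H 1≤t |H|≤ none with m≤n⇒m<n∨m≡n |H|≤
  ... | inj₂ |H| with coTwoEdges H |H| none
  ...   | disjoint a b c d R H↭ a≁b c≁d     = map₂ (|H| ,_) (classify-disjoint |H| a b c d R H↭ a≁b c≁d)
  ...   | triangle a b c R H↭ a≁b b≁c a≁c   = map₂ (|H| ,_) (classify-triangle 1≤t |H| a b c R H↭ a≁b b≁c a≁c)
  classify {t} H 1≤t |H|≤ none | inj₁ (s≤s |H|<) with m≤n⇒m<n∨m≡n |H|<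
  -- At most `suc t` vertices: there are at most `suc t` cliques of size `t`.
  ...   | inj₁ (s≤s |H|<<) = inj₁ (≤-trans (cliques-length≤suc t H |H|<<) (≤-by (2 + t) (lemma t)))
    where
    lemma : ∀ t → suc t + (2 + t) ≡ 3 + 2 * t
    lemma = solve-∀
  -- Exactly `2 + t` vertices: they do not form a clique, and one non-edge already leaves at most
  -- `1 + 2 * t` cliques.
  ...   | inj₂ |H| with complete⊎nonadjacent H
  ...     | inj₁ HH = contradiction (complete⇒cliques H HH)
    (λ 1≤ → <⇒≢ 1≤ (≡-sym (≡-trans (cong (λ u → cliques _~_ u H) |H|) none)))
  ...     | inj₂ (a , b , R , H↭ , a≁b)
    with cliques-nonEdges 2 0 (a ∷ b ∷ []) R {(# 0 , # 1) ∷ []} |H| refl H↭ (a≁b ∷ []) refl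
  ...       | l , refl , H≤ = inj₁ (≤-trans H≤ (≤-by 2 (lemma l)))
    where
    lemma : ∀ l → 1 + l * 2 + 2 ≡ 3 + 2 * (l + 0)
    lemma = solve-∀

  -- Deleting a closed neighbourhood

  complete-degree : ∀ {S} → Complete S → All (λ s → length S ≤ suc (length (filterᵇ (s ~_) S))) S
  complete-degree []                = []
  complete-degree {x ∷ S} (x~S ∷ SS) =
    s≤s (≤-reflexive (cong length (≡-sym (≡-trans (filterᵇ-self x S) (filterᵇ-true (x ~_) x~S)))))
    ∷ All.zipWith (λ {s} (x~s , d) → step {s} x~s d) (x~S , complete-degree SS)
    where
    step : ∀ {s} → x ~ s ≡ true → length S ≤ suc (length (filterᵇ (s ~_) S)) →
           suc (length S) ≤ suc (length (filterᵇ (s ~_) (x ∷ S)))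
    step {s} x~s d rewrite ~-sym s x | x~s = s≤s d

  joined-sym : ∀ {R X} → Joined R X → Joined X R
  joined-sym RX = All.map (All.map (≡-trans (~-sym _ _))) (All.All-swap RX)

  length-filterᵇ-++ : ∀ (p : A → Bool) L M → length (filterᵇ p (L ++ M)) ≡ length (filterᵇ p L) + length (filterᵇ p M)
  length-filterᵇ-++ p L M = ≡-trans (cong length (filterᵇ-++ p L M)) (length-++ (filterᵇ p L))

  -- A vertex of `S` is adjacent to all `d` other vertices of `S ++ X`, so its degree is exhausted
  -- before `W`.
  separated : ∀ {d S X W} → Complete S → Joined S X → length S + length X ≡ suc d →
              (∀ x → length (filterᵇ (x ~_) (S ++ X ++ W)) ≤ d) → All (λ s → filterᵇ (s ~_) W ≡ []) S
  separated {d} {S} {X} {W} SS SX |SX| deg = All.zipWith (λ {s} (dS , s~X) → empty s dS s~X) (complete-degree SS , SX)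
    where
    open ≤-Reasoning
    length≡0 : ∀ {L : List A} → length L ≤ 0 → L ≡ []
    length≡0 {[]} _ = refl
    empty : ∀ s → length S ≤ suc (length (filterᵇ (s ~_) S)) → All (λ x → s ~ x ≡ true) X → filterᵇ (s ~_) W ≡ []
    empty s dS s~X = length≡0 (+-cancelˡ-≤ d _ _ (s≤s⁻¹ (begin
      suc d + length (filterᵇ (s ~_) W)                  ≡⟨ cong (_+ length (filterᵇ (s ~_) W)) |SX| ⟨
      length S + length X + length (filterᵇ (s ~_) W)    ≡⟨ +-assoc (length S) _ _ ⟩
      length S + (length X + length (filterᵇ (s ~_) W))  ≤⟨ +-monoˡ-≤ _ dS ⟩
      suc (length (filterᵇ (s ~_) S)) + (length X + length (filterᵇ (s ~_) W))
        ≡⟨ cong (λ M → suc (length (filterᵇ (s ~_) S)) + (length M + length (filterᵇ (s ~_) W))) (filterᵇ-true (s ~_) s~X) ⟨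
      suc (length (filterᵇ (s ~_) S)) + (length (filterᵇ (s ~_) X) + length (filterᵇ (s ~_) W))
        ≡⟨ cong (suc (length (filterᵇ (s ~_) S)) +_) (length-filterᵇ-++ (s ~_) X W) ⟨
      suc (length (filterᵇ (s ~_) S)) + length (filterᵇ (s ~_) (X ++ W))
        ≡⟨ cong suc (length-filterᵇ-++ (s ~_) S (X ++ W)) ⟨
      suc (length (filterᵇ (s ~_) (S ++ X ++ W)))        ≤⟨ s≤s (deg s) ⟩
      suc d                                              ≡⟨ +-identityʳ (suc d) ⟨
      suc d + 0                                          ∎)))

  cliques-∷-lowDegree : ∀ {t} x M → length (filterᵇ (x ~_) M) < t → cliques _~_ (suc t) (x ∷ M) ≡ cliques _~_ (suc t) M
  cliques-∷-lowDegree {t} x M few = ≡-trans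
    (cong (cliques _~_ (suc t) M +_) (cliques-length< t (filterᵇ (x ~_) M) few)) (+-identityʳ _)

  -- A clique uses at most one of `a` and `b` and at most one vertex of `M`, hence fewer than `t`
  -- vertices.
  cliques-nonadjacent : ∀ {t} a b M → a ~ b ≡ false → length M ≤ 1 → 3 ≤ t → cliques _~_ t (a ∷ b ∷ M) ≡ 0
  cliques-nonadjacent {suc t} a b M a≁b |M| (s≤s 2≤t) rewrite a≁b = cong₂ _+_
    (cliques-length< (suc t) (b ∷ M) (s≤s (≤-trans (s≤s |M|) 2≤t)))
    (cliques-length< t (filterᵇ (a ~_) M) (≤-trans (s≤s (≤-trans (length-filterᵇ≤ (a ~_) M) |M|)) 2≤t))

  -- The vertices of X are removed one at a time; each has at most two neighbours among the later
  -- ones and W, except p, whose three possible neighbours include the non-adjacent q and q′.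
  cliques-X++W : ∀ {t} p q q′ y W → let X = p ∷ q ∷ q′ ∷ y ∷ [] in 3 ≤ t →
    p ~ q ≡ true → p ~ q′ ≡ true → q ~ q′ ≡ false → 1 ≤ length (filterᵇ (y ~_) (p ∷ q ∷ q′ ∷ [])) →
    All (λ x → length (filterᵇ (x ~_) (X ++ W)) ≤ 3) X →
    cliques _~_ (suc t) (X ++ W) ≡ cliques _~_ (suc t) W
  cliques-X++W {t} p q q′ y W 3≤t p~q p~q′ q≁q′ y~ (dp ∷ dq ∷ dq′ ∷ dy ∷ []) =
    ≡-trans (cong (cliques _~_ (suc t) (q ∷ q′ ∷ y ∷ W) +_) p-none)
    (≡-trans (+-identityʳ _)
    (≡-trans (cliques-∷-lowDegree q (q′ ∷ y ∷ W) (later q (p ∷ []) _ (nonempty-filterᵇ (q ~_) (p ∷ []) (# 0) (≡-trans (~-sym q p) p~q)) dq))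
    (≡-trans (cliques-∷-lowDegree q′ (y ∷ W) (later q′ (p ∷ q ∷ []) _ (nonempty-filterᵇ (q′ ~_) (p ∷ q ∷ []) (# 0) (≡-trans (~-sym q′ p) p~q′)) dq′))
             (cliques-∷-lowDegree y W (later y (p ∷ q ∷ q′ ∷ []) W y~ dy)))))
    where
    later : ∀ x L M → 1 ≤ length (filterᵇ (x ~_) L) → length (filterᵇ (x ~_) (L ++ x ∷ M)) ≤ 3 →
            length (filterᵇ (x ~_) M) < t
    later x L M x~ d = ≤-trans (≤-trans (+-mono-≤ x~ (≤-reflexive (cong length (≡-sym (filterᵇ-self x M)))))
      (≤-trans (≤-reflexive (≡-sym (length-filterᵇ-++ (x ~_) L (x ∷ M)))) d)) 3≤t
    nbrs-p : filterᵇ (p ~_) (q ∷ q′ ∷ y ∷ W) ≡ q ∷ q′ ∷ filterᵇ (p ~_) (y ∷ W)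
    nbrs-p rewrite p~q | p~q′ = refl
    p-none : cliques _~_ t (filterᵇ (p ~_) (q ∷ q′ ∷ y ∷ W)) ≡ 0
    p-none = ≡-trans (cong (cliques _~_ t) nbrs-p) (cliques-nonadjacent q q′ (filterᵇ (p ~_) (y ∷ W)) q≁q′
      (s≤s⁻¹ (s≤s⁻¹ (subst (λ L → length L ≤ 3) (≡-trans (filterᵇ-self p _) nbrs-p) dp))) 3≤t)

  -- With `S = v ∷ R`, the closed neighbourhood of `v` is `S ++ X`. No edge joins `S` to `W`, so
  -- each clique lies in `S ++ X` or in `X ++ W`, and in the latter the vertices of `X` contribute
  -- nothing.
  reduce : ∀ {t U v U′} → 3 ≤ t → (∀ x → length (filterᵇ (x ~_) U) ≤ 3 + t) → U ↭ v ∷ U′ →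
           length (filterᵇ (v ~_) U′) ≡ 3 + t → Reducible (filterᵇ (v ~_) U′) →
           cliques _~_ (suc t) U ≤ suc t * 4 + cliques _~_ (suc t) (filterᵇ (not ∘ (v ~_)) U′)
  reduce {t} {U} {v} {U′} 3≤t deg U↭ |H| red = begin
    cliques _~_ (suc t) U             ≡⟨ cliques-↭ (suc t) U↭SXW ⟩
    cliques _~_ (suc t) (S ++ X ++ W) ≤⟨ cliques-separated (suc t) S X W (separated SS SX |SX| deg′) ⟩
    cliques _~_ (suc t) (S ++ X) + cliques _~_ (suc t) (X ++ W)
      ≤⟨ +-mono-≤ inside (≤-reflexive (cliques-X++W p q q′ y W 3≤t p~q p~q′ q≁q′ y~ X-degrees)) ⟩
    suc t * 4 + cliques _~_ (suc t) W ∎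
    where
    open ≤-Reasoning
    open Reducible red
    S W : List A
    S = v ∷ R
    W = filterᵇ (not ∘ (v ~_)) U′
    U↭SXW : U ↭ S ++ X ++ W
    U↭SXW = ↭-trans U↭ (prep v (↭-trans (filterᵇ-↭-split (v ~_) U′)
      (↭-trans (++⁺ʳ W H↭) (subst (λ L → (R ++ X) ++ W ↭ L) (++-assoc R X W) refl))))
    v~RX : All (λ x → v ~ x ≡ true) (R ++ X)
    v~RX = All-resp-↭ H↭ (filterᵇ-all (v ~_) U′)
    SS : Complete S
    SS = All.++⁻ˡ R v~RX ∷ R-complete
    SX : Joined S X
    SX = All.++⁻ʳ R v~RX ∷ R-joined-X
    |SX| : length S + length X ≡ suc (3 + t)
    |SX| = cong suc (≡-trans (≡-sym (length-++ R)) (≡-trans (≡-sym (↭-length H↭)) |H|))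
    |S| : length S ≡ t
    |S| = +-cancelʳ-≡ 4 (length S) t (≡-trans |SX| (+-comm 4 t))
    deg′ : ∀ x → length (filterᵇ (x ~_) (S ++ X ++ W)) ≤ 3 + t
    deg′ x = ≤-trans (≤-reflexive (≡-sym (length-filterᵇ-↭ (x ~_) U↭SXW))) (deg x)
    X-degrees : All (λ x → length (filterᵇ (x ~_) (X ++ W)) ≤ 3) X
    -- A vertex of `X` spends `t` of its at most `3 + t` neighbours on `S`.
    X-degrees = All.map (λ {x} x~S → +-cancelˡ-≤ t _ _ (begin
      t + length (filterᵇ (x ~_) (X ++ W))        ≡⟨ cong (_+ length (filterᵇ (x ~_) (X ++ W))) |S| ⟨
      length S + length (filterᵇ (x ~_) (X ++ W))
        ≡⟨ cong (λ L → length L + length (filterᵇ (x ~_) (X ++ W))) (filterᵇ-true (x ~_) x~S) ⟨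
      length (filterᵇ (x ~_) S) + length (filterᵇ (x ~_) (X ++ W)) ≡⟨ length-filterᵇ-++ (x ~_) S (X ++ W) ⟨
      length (filterᵇ (x ~_) (S ++ X ++ W))       ≤⟨ deg′ x ⟩
      3 + t                                       ≡⟨ +-comm 3 t ⟩
      t + 3                                       ∎)) (joined-sym SX)
    inside : cliques _~_ (suc t) (S ++ X) ≤ suc t * 4
    inside = begin
      cliques _~_ (suc t) (S ++ X)         ≡⟨ cong (λ u → cliques _~_ u (S ++ X)) (≡-trans (+-comm 1 t) (cong (_+ 1) (≡-sym |S|))) ⟩
      -- All of `S` with one of the four vertices of `X`, or `S` minus one of its `t` vertices with
      -- one of at most four edges of `X`.
      cliques _~_ (length S + 1) (S ++ X)  ≤⟨ cliques-++≤ 1 S X X-triangle ⟩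
      4 + length S * cliques _~_ 2 X       ≤⟨ +-monoʳ-≤ 4 (*-mono-≤ (≤-reflexive |S|) X-edges) ⟩
      suc t * 4                            ∎

  -- (2t + 3)(t + 4) ≤ 4(t + 1)² holds exactly from t = 3 on.
  average : ∀ {t} c l → 3 ≤ t → suc t * c ≤ l * (3 + 2 * t) → c * (4 + t) ≤ suc t * 4 * l
  average {suc (suc (suc s))} c l (s≤s (s≤s (s≤s _))) avg = *-cancelˡ-≤ (4 + s) (begin
    (4 + s) * (c * (7 + s))         ≡⟨ *-assoc (4 + s) c (7 + s) ⟨
    (4 + s) * c * (7 + s)           ≤⟨ *-monoˡ-≤ (7 + s) avg ⟩
    l * (3 + 2 * (3 + s)) * (7 + s) ≤⟨ ≤-by (l * (1 + 9 * s + 2 * (s * s))) (lemma l s) ⟩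
    (4 + s) * ((4 + s) * 4 * l)     ∎)
    where
    open ≤-Reasoning
    lemma : ∀ l s → l * (3 + 2 * (3 + s)) * (7 + s) + l * (1 + 9 * s + 2 * (s * s)) ≡ (4 + s) * ((4 + s) * 4 * l)
    lemma = solve-∀

  -- The density bound

  -- The bound `n` on the number of vertices makes the recursion on the remainder `W` structural.
  -- The last hypothesis encodes clique number at most `2 + t`.
  density : ∀ {t} → 3 ≤ t → ∀ n U → length U ≤ n → (∀ x → length (filterᵇ (x ~_) U) ≤ 3 + t) →
            cliques _~_ (3 + t) U ≡ 0 → cliques _~_ (suc t) U * (4 + t) ≤ suc t * 4 * length U
  density {t} 3≤t n U |U|≤ deg none
    with all⊎exists (λ v → cliques _~_ t (filterᵇ (v ~_) U) ≤ᵇ 3 + 2 * t) U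
  ... | inj₁ few = average (cliques _~_ (suc t) U) (length U) 3≤t (≤-trans
    (≤-reflexive (≡-sym (sum-cliques-neighbourhood t U)))
    (sum-map-≤ (All.map (λ {v} ≡true → ≤ᵇ⇒≤ _ _ (Equivalence.from T-≡ ≡true)) few)))
  ... | inj₂ (v , U′ , U↭ , many)
    with classify (filterᵇ (v ~_) U′) (≤-trans (s≤s z≤n) 3≤t)
           (≤-trans (≤-reflexive |H|) (deg v))
           -- A clique of size `2 + t` in the neighbourhood would extend by `v` to a forbidden one.
           (m+n≡0⇒n≡0 (cliques _~_ (3 + t) U′) (≡-trans (≡-sym (cliques-↭ (3 + t) U↭)) none))
    where
    |H| : length (filterᵇ (v ~_) U′) ≡ length (filterᵇ (v ~_) U)
    |H| = ≡-trans (cong length (≡-sym (filterᵇ-self v U′))) (≡-sym (length-filterᵇ-↭ (v ~_) U↭))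
  -- The vertex `v` was chosen for violating exactly this bound.
  ... | inj₁ few = contradiction (Equivalence.to T-≡ (≤⇒≤ᵇ (≤-trans (≤-reflexive same) few))) (λ ≡true → contradiction (≡-trans (≡-sym ≡true) many) λ ())
    where
    same : cliques _~_ t (filterᵇ (v ~_) U) ≡ cliques _~_ t (filterᵇ (v ~_) U′)
    same = ≡-trans (cliques-↭ t (filter-↭ (T? ∘ (v ~_)) U↭)) (cong (cliques _~_ t) (filterᵇ-self v U′))
  density {t} 3≤t zero U |U|≤ deg none | inj₂ (v , U′ , U↭ , many) | inj₂ _ =
    contradiction (≤-trans (≤-reflexive (≡-sym (↭-length U↭))) |U|≤) λ ()
  density {t} 3≤t (suc n) U |U|≤ deg none | inj₂ (v , U′ , U↭ , many) | inj₂ (|H| , red) = begin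
    cliques _~_ (suc t) U * (4 + t)                          ≤⟨ *-monoˡ-≤ (4 + t) (reduce 3≤t deg U↭ |H| red) ⟩
    (suc t * 4 + cliques _~_ (suc t) W) * (4 + t)            ≡⟨ *-distribʳ-+ (4 + t) (suc t * 4) _ ⟩
    -- Deletion removes `4 + t` vertices and at most `suc t * 4` cliques, precisely the target
    -- ratio.
    suc t * 4 * (4 + t) + cliques _~_ (suc t) W * (4 + t)
      ≤⟨ +-monoʳ-≤ (suc t * 4 * (4 + t)) (density 3≤t n W |W|≤ deg-W none-W) ⟩
    suc t * 4 * (4 + t) + suc t * 4 * length W               ≡⟨ *-distribˡ-+ (suc t * 4) (4 + t) (length W) ⟨
    suc t * 4 * (4 + t + length W)                           ≡⟨ cong (suc t * 4 *_) |U| ⟨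
    suc t * 4 * length U                                     ∎
    where
    open ≤-Reasoning
    W : List A
    W = filterᵇ (not ∘ (v ~_)) U′
    |U| : length U ≡ 4 + t + length W
    |U| = ≡-trans (↭-length U↭) (cong suc (≡-trans (↭-length (filterᵇ-↭-split (v ~_) U′))
      (≡-trans (length-++ (filterᵇ (v ~_) U′)) (cong (_+ length W) |H|))))
    |W|≤ : length W ≤ n
    |W|≤ = ≤-trans (length-filterᵇ≤ _ U′) (s≤s⁻¹ (≤-trans (≤-reflexive (≡-sym (↭-length U↭))) |U|≤))
    W⊆ : W ⊆ v ∷ U′
    W⊆ = v ∷ʳ filter-⊆ _ U′
    deg-W : ∀ x → length (filterᵇ (x ~_) W) ≤ 3 + t
    deg-W x = ≤-trans (length-mono-≤ (filter⁺ (T? ∘ (x ~_)) (T? ∘ (x ~_)) (λ { refl → id }) W⊆))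
      (≤-trans (≤-reflexive (≡-sym (length-filterᵇ-↭ (x ~_) U↭))) (deg x))
    none-W : cliques _~_ (3 + t) W ≡ 0
    none-W = n≤0⇒n≡0 (≤-trans (cliques-⊆ (3 + t) W⊆) (≤-reflexive (≡-trans (≡-sym (cliques-↭ (3 + t) U↭)) none)))

-- From counting subsets to counting in lists

count-++ : ∀ (p : A → Bool) L M → count p (L ++ M) ≡ count p L + count p M
count-++ p []      M = refl
count-++ p (x ∷ L) M rewrite count-++ p L M = ≡-sym (+-assoc (if p x then 1 else 0) (count p L) (count p M))

count-map : ∀ (p : A → Bool) (f : B → A) L → count p (map f L) ≡ count (p ∘ f) L
count-map p f []      = refl
count-map p f (x ∷ L) = cong ((if p (f x) then 1 else 0) +_) (count-map p f L)

count-cong : {p q : A → Bool} → p ≗ q → ∀ L → count p L ≡ count q L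
count-cong p≗q []      = refl
count-cong p≗q (x ∷ L) = cong₂ (λ b n → (if b then 1 else 0) + n) (p≗q x) (count-cong p≗q L)

count-none : {p : A → Bool} → (∀ x → p x ≡ false) → ∀ L → count p L ≡ 0
count-none p≗ []      = refl
count-none p≗ (x ∷ L) rewrite p≗ x = count-none p≗ L

count≡length : ∀ (p : A → Bool) L → count p L ≡ length (filterᵇ p L)
count≡length p []      = refl
count≡length p (x ∷ L) with p x
... | true  = cong suc (count≡length p L)
... | false = count≡length p L

count-allSubsets : ∀ {n} (p : Subset (suc n) → Bool) → count p (allSubsets (suc n)) ≡
                   count (p ∘ (false Vec.∷_)) (allSubsets n) + count (p ∘ (true Vec.∷_)) (allSubsets n)
count-allSubsets {n} p = ≡-trans (count-++ p (map (false Vec.∷_) (allSubsets n)) _)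
  (cong₂ _+_ (count-map p _ (allSubsets n)) (count-map p _ (allSubsets n)))

count-allSubsets-∃ : ∀ {n} (p : Subset n → Bool) s → p s ≡ true → 1 ≤ count p (allSubsets n)
count-allSubsets-∃ p Vec.[] ps rewrite ps = ≤-refl
count-allSubsets-∃ {suc n} p (false Vec.∷ s) ps rewrite count-allSubsets p =
  ≤-trans (count-allSubsets-∃ (p ∘ (false Vec.∷_)) s ps) (m≤m+n _ _)
count-allSubsets-∃ {suc n} p (true Vec.∷ s) ps rewrite count-allSubsets p =
  ≤-trans (count-allSubsets-∃ (p ∘ (true Vec.∷_)) s ps) (m≤n+m _ (count (p ∘ (false Vec.∷_)) (allSubsets n)))

tailGraph : ∀ {n} → Graph (suc n) → Graph n
tailGraph G = record
  { adj    = λ i j → adj G (suc i) (suc j)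
  ; sym    = λ i j → sym G (suc i) (suc j)
  ; irrefl = λ i → irrefl G (suc i)
  }

-- Adding a vertex to the clique restricts Q to its neighbours.
cliqueIn : ∀ {n} → Graph n → (Fin n → Bool) → Subset n → Bool
cliqueIn G Q Vec.[]          = true
cliqueIn G Q (false Vec.∷ s) = cliqueIn (tailGraph G) (Q ∘ suc) s
cliqueIn G Q (true  Vec.∷ s) = Q zero ∧ cliqueIn (tailGraph G) (λ j → Q (suc j) ∧ adj G zero (suc j)) s

-- Splitting the subsets by membership of the first vertex reproduces the recursion of `cliques`.
count-cliqueIn : ∀ {n} (G : Graph n) Q t →
  count (λ s → (∣ s ∣ ≡ᵇ t) ∧ cliqueIn G Q s) (allSubsets n) ≡ cliques (adj G) t (filterᵇ Q (allFin n))
count-cliqueIn {zero}  G Q zero    = refl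
count-cliqueIn {zero}  G Q (suc t) = refl
count-cliqueIn {suc n} G Q zero    = ≡-trans (count-allSubsets (λ s → (∣ s ∣ ≡ᵇ 0) ∧ cliqueIn G Q s))
  (cong₂ _+_ (count-cliqueIn (tailGraph G) (Q ∘ suc) zero) (count-none (λ _ → refl) (allSubsets n)))
count-cliqueIn {suc n} G Q (suc t) = ≡-trans (count-allSubsets (λ s → (∣ s ∣ ≡ᵇ suc t) ∧ cliqueIn G Q s))
  (≡-trans (cong₂ _+_ (count-cliqueIn (tailGraph G) (Q ∘ suc) (suc t)) refl)
  (≡-trans (split (Q zero)) (cong (cliques (adj G) (suc t)) (≡-sym filterᵇ-allFin))))
  where
  N : List (Fin n)
  N = filterᵇ (Q ∘ suc) (allFin n)
  tail≡ : filterᵇ Q (tabulate suc) ≡ map suc N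
  tail≡ = ≡-trans (cong (filterᵇ Q) (≡-sym (map-tabulate id suc))) (filterᵇ-map Q suc (allFin n))
  filterᵇ-allFin : filterᵇ Q (allFin (suc n)) ≡ (if Q zero then zero ∷ map suc N else map suc N)
  filterᵇ-allFin with Q zero
  ... | true  = cong (zero ∷_) tail≡
  ... | false = tail≡
  split : ∀ b → cliques (adj (tailGraph G)) (suc t) N +
                count (λ s → (∣ s ∣ ≡ᵇ t) ∧ (b ∧ cliqueIn (tailGraph G) (λ j → Q (suc j) ∧ adj G zero (suc j)) s))
                      (allSubsets n)
              ≡ cliques (adj G) (suc t) (if b then zero ∷ map suc N else map suc N)
  split false = ≡-trans
    (cong₂ _+_ (≡-sym (cliques-map suc (suc t) N)) (count-none (λ s → ∧-zeroʳ (∣ s ∣ ≡ᵇ t)) (allSubsets n)))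
    (+-identityʳ _)
  split true = cong₂ _+_ (≡-sym (cliques-map suc (suc t) N))
    (≡-trans (count-cliqueIn (tailGraph G) _ t)
    (≡-trans (cong (cliques (adj (tailGraph G)) t) (≡-sym (filterᵇ-∧ (adj G zero ∘ suc) (Q ∘ suc) (allFin n))))
    (≡-trans (≡-sym (cliques-map suc t (filterᵇ (adj G zero ∘ suc) N)))
             (cong (cliques (adj G) t) (≡-sym (filterᵇ-map (adj G zero) suc N))))))

-- A pointwise description through which the quadratic test `isClique` and the recursive test
-- `cliqueIn` are compared.
IsCliqueIn : ∀ {n} → Graph n → (Fin n → Bool) → Subset n → Set
IsCliqueIn G Q s = (∀ i → Vec.lookup s i ≡ true → Q i ≡ true) ×
  (∀ i j → Vec.lookup s i ≡ true → Vec.lookup s j ≡ true → i ≡ j ⊎ adj G i j ≡ true)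

∧-true : ∀ {x y} → x ∧ y ≡ true → x ≡ true × y ≡ true
∧-true {true} {true} refl = refl , refl

cliqueIn-sound : ∀ {n} (G : Graph n) Q s → cliqueIn G Q s ≡ true → IsCliqueIn G Q s
cliqueIn-sound G Q Vec.[] _ = (λ ()) , λ ()
cliqueIn-sound G Q (false Vec.∷ s) eq with cliqueIn-sound (tailGraph G) (Q ∘ suc) s eq
... | inQ , pairs = inQ′ , pairs′
  where
  inQ′ : ∀ i → Vec.lookup (false Vec.∷ s) i ≡ true → Q i ≡ true
  inQ′ (suc i) = inQ i
  pairs′ : ∀ i j → Vec.lookup (false Vec.∷ s) i ≡ true → Vec.lookup (false Vec.∷ s) j ≡ true → i ≡ j ⊎ adj G i j ≡ true
  pairs′ (suc i) (suc j) si sj = map₁ (cong suc) (pairs i j si sj)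
cliqueIn-sound G Q (true Vec.∷ s) eq with ∧-true {Q zero} eq
... | Q0 , eq′ with cliqueIn-sound (tailGraph G) (λ j → Q (suc j) ∧ adj G zero (suc j)) s eq′
...   | inQ , pairs = inQ′ , pairs′
  where
  inQ′ : ∀ i → Vec.lookup (true Vec.∷ s) i ≡ true → Q i ≡ true
  inQ′ zero    _  = Q0
  inQ′ (suc i) si = proj₁ (∧-true (inQ i si))
  pairs′ : ∀ i j → Vec.lookup (true Vec.∷ s) i ≡ true → Vec.lookup (true Vec.∷ s) j ≡ true → i ≡ j ⊎ adj G i j ≡ true
  pairs′ zero    zero    si sj = inj₁ refl
  pairs′ zero    (suc j) si sj = inj₂ (proj₂ (∧-true {Q (suc j)} (inQ j sj)))
  pairs′ (suc i) zero    si sj = inj₂ (≡-trans (sym G (suc i) zero) (proj₂ (∧-true {Q (suc i)} (inQ i si))))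
  pairs′ (suc i) (suc j) si sj = map₁ (cong suc) (pairs i j si sj)

cliqueIn-complete : ∀ {n} (G : Graph n) Q s → IsCliqueIn G Q s → cliqueIn G Q s ≡ true
cliqueIn-complete G Q Vec.[] _ = refl
cliqueIn-complete G Q (false Vec.∷ s) (inQ , pairs) = cliqueIn-complete (tailGraph G) (Q ∘ suc) s
  ((λ i → inQ (suc i)) , λ i j si sj → map₁ Fin.suc-injective (pairs (suc i) (suc j) si sj))
cliqueIn-complete G Q (true Vec.∷ s) (inQ , pairs) = cong₂ _∧_ (inQ zero refl)
  (cliqueIn-complete (tailGraph G) (λ j → Q (suc j) ∧ adj G zero (suc j)) s
    ((λ i si → cong₂ _∧_ (inQ (suc i) si) (adj-zero i (pairs zero (suc i) refl si))) ,
     λ i j si sj → map₁ Fin.suc-injective (pairs (suc i) (suc j) si sj)))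
  where
  adj-zero : ∀ i → zero ≡ suc i ⊎ adj G zero (suc i) ≡ true → adj G zero (suc i) ≡ true
  adj-zero i (inj₁ ())
  adj-zero i (inj₂ a) = a

allB-sound : ∀ (p : A → Bool) {L x} → allB p L ≡ true → x ∈ L → p x ≡ true
allB-sound p {y ∷ L} eq (here refl) = proj₁ (∧-true {p y} eq)
allB-sound p {y ∷ L} eq (there x∈)  = allB-sound p (proj₂ (∧-true {p y} eq)) x∈

allB-complete : ∀ (p : A → Bool) L → (∀ x → p x ≡ true) → allB p L ≡ true
allB-complete p []      all = refl
allB-complete p (x ∷ L) all = cong₂ _∧_ (all x) (allB-complete p L all)

pairCheck-sound : ∀ {n} {i j : Fin n} {a b c} → not (a ∧ b) ∨ ⌊ i ≟ j ⌋ ∨ c ≡ true → a ≡ true → b ≡ true →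
                  i ≡ j ⊎ c ≡ true
pairCheck-sound {i = i} {j} eq refl refl with i ≟ j
... | yes i≡j = inj₁ i≡j
... | no  _   = inj₂ eq

pairCheck-complete : ∀ {n} {i j : Fin n} a b {c} → (a ≡ true → b ≡ true → i ≡ j ⊎ c ≡ true) →
                     not (a ∧ b) ∨ ⌊ i ≟ j ⌋ ∨ c ≡ true
pairCheck-complete false b     _ = refl
pairCheck-complete true  false _ = refl
pairCheck-complete {i = i} {j} true true h with i ≟ j | h refl refl
... | yes _   | _        = refl
... | no i≢j  | inj₁ i≡j = contradiction i≡j i≢j
... | no _    | inj₂ c   = c

isClique-sound : ∀ {n} (G : Graph n) s → isClique G s ≡ true → IsCliqueIn G (λ _ → true) s
isClique-sound G s eq = (λ _ _ → refl) , λ i j →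
  pairCheck-sound (allB-sound _ (allB-sound _ eq (∈-allFin i)) (∈-allFin j))

isClique-complete : ∀ {n} (G : Graph n) s → IsCliqueIn G (λ _ → true) s → isClique G s ≡ true
isClique-complete {n} G s (_ , pairs) = allB-complete _ (allFin n) λ i → allB-complete _ (allFin n) λ j →
  pairCheck-complete (Vec.lookup s i) (Vec.lookup s j) (pairs i j)

isClique≡cliqueIn : ∀ {n} (G : Graph n) s → isClique G s ≡ cliqueIn G (λ _ → true) s
isClique≡cliqueIn G s = ≡-from-true
  (λ eq → cliqueIn-complete G _ s (isClique-sound G s eq))
  (λ eq → isClique-complete G s (cliqueIn-sound G _ s eq))
  where
  ≡-from-true : ∀ {x y} → (x ≡ true → y ≡ true) → (y ≡ true → x ≡ true) → x ≡ y
  ≡-from-true {true}          f g = ≡-sym (f refl)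
  ≡-from-true {false} {true}  f g = g refl
  ≡-from-true {false} {false} f g = refl

k≡cliques : ∀ {n} t (G : Graph n) → k t G ≡ cliques (adj G) t (allFin n)
k≡cliques {n} t G = ≡-trans
  (count-cong (λ s → cong ((∣ s ∣ ≡ᵇ t) ∧_) (isClique≡cliqueIn G s)) (allSubsets n))
  (≡-trans (count-cliqueIn G (λ _ → true) t)
           (cong (cliques (adj G) t) (filterᵇ-true (λ _ → true) (All.universal (λ _ → refl) (allFin n)))))

-- This turns the bound on clique sizes into the vanishing count that `density` takes as hypothesis.
k-suc-clique-number : ∀ {n ω} (G : Graph n) → (∀ s → isClique G s ≡ true → ∣ s ∣ ≤ ω) → k (suc ω) G ≡ 0
k-suc-clique-number {n} {ω} G bound = count-none large (allSubsets n)
  where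
  large : ∀ s → (∣ s ∣ ≡ᵇ suc ω) ∧ isClique G s ≡ false
  large s with ∣ s ∣ ≡ᵇ suc ω in size | isClique G s in clique
  ... | false | _     = refl
  ... | true  | false = refl
  ... | true  | true  = contradiction (bound s clique)
    (<⇒≱ (≤-reflexive (≡-sym (≡ᵇ⇒≡ ∣ s ∣ (suc ω) (Equivalence.from T-≡ size)))))

degree< : ∀ {n} (G : Graph n) i → degree G i < n
degree< {n} G i = subst (_< n) (≡-sym (count≡length (adj G i) (allFin n)))
  (≤-trans (filter-notAll (T? ∘ adj G i) (allFin n) (lose (∈-allFin i) (λ adj-ii → contradiction
      (≡-trans (≡-sym (Equivalence.to T-≡ adj-ii)) (irrefl G i)) λ ())))
    (≤-reflexive (length-tabulate id)))

-- Cliques of the Turán graph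

applyUpTo-+ : ∀ (g : ℕ → A) m n → applyUpTo g (m + n) ≡ applyUpTo g m ++ applyUpTo (g ∘ (m +_)) n
applyUpTo-+ g zero    n = refl
applyUpTo-+ g (suc m) n = cong (g 0 ∷_) (applyUpTo-+ (g ∘ suc) m n)

tabulate-toℕ : ∀ (g : ℕ → A) n → tabulate {n = n} (g ∘ toℕ) ≡ applyUpTo g n
tabulate-toℕ g zero    = refl
tabulate-toℕ g (suc n) = cong (g 0 ∷_) (tabulate-toℕ (g ∘ suc) n)

module TuranCliques (t : ℕ) where

  r : ℕ
  r = 2 + t

  -- Adjacency is taken on part numbers; vertices in one part become repeated list entries, which
  -- are non-adjacent by irreflexivity.
  _≁_ : ℕ → ℕ → Bool
  a ≁ b = not (a ≡ᵇ b)

  ≢⇒≁ : ∀ {a b} → a ≢ b → a ≁ b ≡ true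
  ≢⇒≁ {a} {b} a≢b with a ≡ᵇ b in eq
  ... | false = refl
  ... | true  = contradiction (≡ᵇ⇒≡ a b (Equivalence.from T-≡ eq)) a≢b

  ≁-irrefl : ∀ a → a ≁ a ≡ false
  ≁-irrefl zero    = refl
  ≁-irrefl (suc a) = ≁-irrefl a

  ≁-sym : ∀ a b → a ≁ b ≡ b ≁ a
  ≁-sym zero    zero    = refl
  ≁-sym zero    (suc b) = refl
  ≁-sym (suc a) zero    = refl
  ≁-sym (suc a) (suc b) = ≁-sym a b

  open SymmetricGraph _≁_ ≁-sym ≁-irrefl

  -- Parts 0 and 1 have two vertices each and make up the four-cycle `X`; the other `t` parts are
  -- singletons and make up the clique `R`. The Turán graph thus has the shape treated in `reduce`.
  R X : List ℕ
  R = applyUpTo (λ i → (2 + i) % r) t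
  X = 0 ∷ 1 ∷ 0 ∷ 1 ∷ []

  R-part : ∀ {i} → i < t → (2 + i) % r ≡ 2 + i
  R-part i<t = m<n⇒m%n≡m (s≤s (s≤s i<t))

  R-complete : Complete R
  R-complete = AllPairs.applyUpTo⁺₁ _ t λ {i} {j} i<j j<t → ≢⇒≁ λ eq →
    <⇒≢ i<j (+-cancelˡ-≡ 2 i j (≡-trans (≡-sym (R-part (<-trans i<j j<t))) (≡-trans eq (R-part j<t))))

  R-joined-X : Joined R X
  R-joined-X = All.applyUpTo⁺₁ _ t λ i<t → subst (λ a → All (λ b → a ≁ b ≡ true) X) (≡-sym (R-part i<t))
    (refl ∷ refl ∷ refl ∷ refl ∷ [])

  parts : map (λ i → toℕ i % r) (allFin (r + 2)) ↭ R ++ X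
  parts = subst (_↭ R ++ X) (≡-sym parts≡)
    (↭-trans (++-comm (0 ∷ 1 ∷ []) (R ++ 0 ∷ 1 ∷ []))
      (subst (λ L → (R ++ 0 ∷ 1 ∷ []) ++ 0 ∷ 1 ∷ [] ↭ L) (++-assoc R _ _) refl))
    where
    parts≡ : map (λ i → toℕ i % r) (allFin (r + 2)) ≡ 0 ∷ 1 ∷ R ++ 0 ∷ 1 ∷ []
    parts≡ = ≡-trans (map-tabulate id (λ i → toℕ i % r))
      (≡-trans (tabulate-toℕ (_% r) (r + 2))
      (≡-trans (applyUpTo-+ (_% r) r 2)
               (cong₂ (λ a b → 0 ∷ 1 ∷ R ++ a ∷ b ∷ [])
                 -- The last two vertices, `r` and `r + 1`, wrap around to parts 0 and 1.
                 (≡-trans (cong (_% r) (+-comm r 0)) ([m+n]%n≡m%n 0 r))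
                 (≡-trans (cong (_% r) (+-comm r 1)) ([m+n]%n≡m%n 1 r)))))

  k-turan : ∀ u → k u (Turan r (r + 2)) ≡ cliques _≁_ u (R ++ X)
  k-turan u = ≡-trans (k≡cliques u (Turan r (r + 2)))
    (≡-trans (≡-sym (cliques-map {_~_ = _≁_} (λ i → toℕ i % r) u (allFin (r + 2)))) (cliques-↭ u parts))

  |R| : length R ≡ t
  |R| = length-applyUpTo _ t

  -- The four vertices and four edges of `X` give `4 + t * 4`, which matches the bound in `reduce`.
  k-turan≥ : suc t * 4 ≤ k (suc t) (Turan r (r + 2))
  k-turan≥ = begin
    4 + t * 4                          ≡⟨ cong (λ l → 4 + l * 4) |R| ⟨
    4 + length R * 4                   ≤⟨ cliques-++-join 1 R X R-complete R-joined-X ⟩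
    cliques _≁_ (length R + 1) (R ++ X) ≡⟨ cong (λ u → cliques _≁_ u (R ++ X)) (≡-trans (cong (_+ 1) |R|) (+-comm t 1)) ⟩
    cliques _≁_ (suc t) (R ++ X)       ≡⟨ k-turan (suc t) ⟨
    k (suc t) (Turan r (r + 2))        ∎
    where open ≤-Reasoning

  -- The four-cycle `X` has no triangle, so there is no clique of size `length R + 3 = suc r`, and
  -- none larger.
  k-turan-large : ∀ u → r < u → k u (Turan r (r + 2)) ≡ 0
  k-turan-large u r<u = ≡-trans (k-turan u) (subst (λ v → cliques _≁_ v (R ++ X) ≡ 0) (m∸n+n≡m r<u)
    (cliques≡0-+ (u ∸ suc r) (suc r) (R ++ X)
      (subst (λ v → cliques _≁_ v (R ++ X) ≡ 0) (≡-trans (cong (_+ 3) |R|) (+-comm t 3)) (cliques-++≡0 3 R X refl))))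

  -- With `r + 2` vertices every degree is at most `suc r`. A clique on more than `r` vertices would
  -- make a vanishing count positive.
  turan-inClass : InClass (suc r) r (Turan r (r + 2))
  turan-inClass = (λ i → s≤s⁻¹ (subst (degree (Turan r (r + 2)) i <_) (+-comm r 2) (degree< (Turan r (r + 2)) i))) ,
    λ s clique → ≮⇒≥ λ r<s → contradiction
      (count-allSubsets-∃ _ s (cong₂ _∧_ (Equivalence.to T-≡ (≡⇒≡ᵇ ∣ s ∣ ∣ s ∣ refl)) clique))
      (<⇒≱ (s≤s (≤-reflexive (k-turan-large ∣ s ∣ r<s))))

-- The limit density is a supremum over `n`, so its value is expressed by an upper bound for every
-- graph in the class and a graph attaining it. Both are cross-multiplied by `n` and the order
-- `r + 2` of the Turán graph.
theorem5p6 : (r : ℕ) .{{_ : NonZero r}} → 5 ≤ r →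
    ((n : ℕ) (G : Graph n) → 1 ≤ n → InClass (suc r) r G →
    k (r ∸ 1) G * (r + 2) ≤ k (r ∸ 1) (Turan r (r + 2)) * n)
    × Σ ℕ (λ n → Σ (Graph n) (λ G → 1 ≤ n × InClass (suc r) r G ×
    (k (r ∸ 1) G * (r + 2) ≡ k (r ∸ 1) (Turan r (r + 2)) * n)))
-- The Turán graph itself attains the bound: for `n` equal to `r + 2` the two sides coincide.
theorem5p6 (suc (suc t)) (s≤s (s≤s 3≤t)) = upper , r + 2 , Turan r (r + 2) , s≤s z≤n , turan-inClass , refl
  where
  open TuranCliques t
  upper : (n : ℕ) (G : Graph n) → 1 ≤ n → InClass (suc r) r G →
          k (suc t) G * (r + 2) ≤ k (suc t) (Turan r (r + 2)) * n
  upper n G _ (deg , ω) = begin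
    k (suc t) G * (r + 2)                            ≡⟨ cong₂ _*_ (k≡cliques (suc t) G) (+-comm r 2) ⟩
    cliques (adj G) (suc t) (allFin n) * (4 + t)
      ≤⟨ density 3≤t (length (allFin n)) (allFin n) ≤-refl
           (λ i → subst (_≤ 3 + t) (count≡length (adj G i) (allFin n)) (deg i))
           (≡-trans (≡-sym (k≡cliques (3 + t) G)) (k-suc-clique-number G ω)) ⟩
    suc t * 4 * length (allFin n)                    ≡⟨ cong (suc t * 4 *_) (length-tabulate {n = n} id) ⟩
    suc t * 4 * n                                    ≤⟨ *-monoˡ-≤ n k-turan≥ ⟩
    k (suc t) (Turan r (r + 2)) * n                  ∎
    where
    open ≤-Reasoning
    open SymmetricGraph (adj G) (sym G) (irrefl G)
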